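{- Let $r \ge 3$ and $n \ge 2r^5$. Let $\mathcal{H}$ be an intersecting $r$-uniform $n$-vertex hypergraph with $\delta_{r-1}^+(\mathcal{H}) \ge 3$ having the maximum number of hyperedges among all intersecting $r$-uniform $n$-vertex hypergraphs with minimum positive co-degree at least $3$. Then $\mathcal{H}$ is a $3$-kernel system.
   Context: A hypergraph is intersecting if every two of its hyperedges share at least one vertex. For a non-empty $r$-uniform hypergraph $\mathcal{H}$, the minimum positive co-degree $\delta_{r-1}^+(\mathcal{H})$ is the largest integer $k$ such that every $(r-1)$-set of vertices that is contained in at least one hyperedge of $\mathcal{H}$ is contained in at least $k$ distinct hyperedges of $\mathcal{H}$; for the empty hypergraph it is $0$. Given integers $r \ge k \ge 1$, an $r$-uniform $k$-kernel system on vertex set $V$ is a hypergraph whose hyperedge set is $\{E \in \binom{V}{r} : |E \cap X| \ge k\}$ for some set $X \subseteq V$ with $|X| = 2k-1$. -}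

module Defs where

open import Data.Fin.Subset using (Subset; inside; outside; _⊆_; _∩_; ∣_∣; Nonempty)
open import Data.Fin.Subset.Properties using (_⊆?_; anySubset?; out⊆; s⊆s)
open import Data.List using (List; []; length; filter; upTo)
open import Data.List.Extrema.Nat using (max; argmax-sel; max≤v⁺; xs≤max)
open import Data.List.Membership.Propositional using (_∈_; lose)
open import Data.List.Membership.Propositional.Properties
  using (∈-filter⁺; ∈-filter⁻; ∈-upTo⁺; ∈-upTo⁻)
open import Data.List.Properties using (length-filter)
open import Data.List.Relation.Unary.All as All using (All)
open import Data.List.Relation.Unary.Any using (Any; any?)
open import Data.List.Relation.Unary.Unique.Propositional using (Unique)
open import Data.Nat using (ℕ; zero; suc; _*_; _∸_; _≤_; _≥_; z≤n; s≤s; s≤s⁻¹)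
open import Data.Nat.Properties using (_≟_; _≤?_; ≤-trans; m∸n≤m; n≤0⇒n≡0)
open import Data.Product using (_×_; _,_; ∃-syntax; proj₁; proj₂)
open import Data.Sum using (inj₁; inj₂)
open import Data.Vec using ([]; _∷_)
open import Function using (id)
open import Function.Bundles using (_⇔_)
open import Relation.Binary.PropositionalEquality using (_≡_; refl; sym; cong; subst)
open import Relation.Nullary using (Dec; ¬_; ¬?)
open import Relation.Nullary.Decidable using (map′; _×-dec_; decidable-stable)

-- The edge set is a duplicate-free list, so its cardinality is the length.
record UniformHypergraph (r n : ℕ) : Set where
  field
    edges    : List (Subset n)
    distinct : Unique edges
    uniform  : All (λ E → ∣ E ∣ ≡ r) edges

open UniformHypergraph public

private
  variable
    r n : ℕ

∣E_∣ : UniformHypergraph r n → ℕ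
∣E H ∣ = length (edges H)

Intersecting : UniformHypergraph r n → Set
Intersecting H = ∀ {E F} → E ∈ edges H → F ∈ edges H → Nonempty (E ∩ F)

degree : UniformHypergraph r n → Subset n → ℕ
degree H S = length (filter (S ⊆?_) (edges H))

PositiveCodegrees≥ : UniformHypergraph r n → ℕ → Set
PositiveCodegrees≥ {r} {n} H k =
  ∀ (S : Subset n) → ∣ S ∣ ≡ r ∸ 1 → Any (S ⊆_) (edges H) → k ≤ degree H S

positiveCodegrees≥? : (H : UniformHypergraph r n) (k : ℕ) → Dec (PositiveCodegrees≥ H k)
positiveCodegrees≥? {r} {n} H k = map′ to from (¬? (anySubset? bad?))
  where
  Bad : Subset n → Set
  Bad S = (∣ S ∣ ≡ r ∸ 1 × Any (S ⊆_) (edges H)) × ¬ (k ≤ degree H S)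

  bad? : ∀ S → Dec (Bad S)
  bad? S = (∣ S ∣ ≟ r ∸ 1 ×-dec any? (S ⊆?_) (edges H)) ×-dec ¬? (k ≤? degree H S)

  to : ¬ (∃[ S ] Bad S) → PositiveCodegrees≥ H k
  to ¬bad S s c = decidable-stable (k ≤? degree H S) (λ k≰ → ¬bad (S , (s , c) , k≰))

  from : PositiveCodegrees≥ H k → ¬ (∃[ S ] Bad S)
  from p (S , (s , c) , k≰) = k≰ (p S s c)

-- The largest k with PositiveCodegrees≥ H k. Searching up to the number of
-- edges loses nothing when H is non-empty (see δ⁺-largest) and gives the
-- conventional value 0 when H is empty (see δ⁺-empty).
δ⁺ : UniformHypergraph r n → ℕ
δ⁺ H = max 0 (filter (positiveCodegrees≥? H) (upTo (suc ∣E H ∣)))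

-- Intended for 1 ≤ k ≤ r.
IsKernelSystem : ℕ → UniformHypergraph r n → Set
IsKernelSystem {r} {n} k H =
  ∃[ X ] ∣ X ∣ ≡ 2 * k ∸ 1
       × (∀ (E : Subset n) → E ∈ edges H ⇔ (∣ E ∣ ≡ r × ∣ E ∩ X ∣ ≥ k))

private
  subset-of-size : ∀ {n} m (E : Subset n) → m ≤ ∣ E ∣ → ∃[ S ] ∣ S ∣ ≡ m × S ⊆ E
  subset-of-size zero    []            _       = [] , refl , id
  subset-of-size m       (outside ∷ E) m≤      =
    let S , s , S⊆E = subset-of-size m E m≤ in outside ∷ S , s , out⊆ S⊆E
  subset-of-size zero    (inside ∷ E)  _       =
    let S , s , S⊆E = subset-of-size zero E z≤n in outside ∷ S , s , out⊆ S⊆E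
  subset-of-size (suc m) (inside ∷ E)  (s≤s m≤) =
    let S , s , S⊆E = subset-of-size m E m≤ in inside ∷ S , cong suc s , s⊆s S⊆E

  bounded : (H : UniformHypergraph r n) {E : Subset n} → E ∈ edges H →
            ∀ {k} → PositiveCodegrees≥ H k → k ≤ ∣E H ∣
  bounded {r} H {E} E∈H p =
    let S , s , S⊆E = subset-of-size (r ∸ 1) E
                        (subst (r ∸ 1 ≤_) (sym (All.lookup (uniform H) E∈H)) (m∸n≤m r 1))
    in ≤-trans (p S s (lose E∈H S⊆E)) (length-filter (S ⊆?_) (edges H))

δ⁺-valid : (H : UniformHypergraph r n) → PositiveCodegrees≥ H (δ⁺ H)
δ⁺-valid H with argmax-sel id 0 (filter (positiveCodegrees≥? H) (upTo (suc ∣E H ∣)))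
... | inj₁ δ≡0 = subst (PositiveCodegrees≥ H) (sym δ≡0) (λ _ _ _ → z≤n)
... | inj₂ δ∈  = proj₂ (∈-filter⁻ (positiveCodegrees≥? H) {xs = upTo (suc ∣E H ∣)} δ∈)

δ⁺-largest : (H : UniformHypergraph r n) {E : Subset n} → E ∈ edges H →
             ∀ {k} → PositiveCodegrees≥ H k → k ≤ δ⁺ H
δ⁺-largest H E∈H p = All.lookup (xs≤max 0 _)
  (∈-filter⁺ (positiveCodegrees≥? H) (∈-upTo⁺ (s≤s (bounded H E∈H p))) p)

δ⁺≤∣E∣ : (H : UniformHypergraph r n) → δ⁺ H ≤ ∣E H ∣
δ⁺≤∣E∣ H = max≤v⁺ z≤n (All.tabulate λ k∈ →
  s≤s⁻¹ (∈-upTo⁻ (proj₁ (∈-filter⁻ (positiveCodegrees≥? H) {xs = upTo (suc ∣E H ∣)} k∈))))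

δ⁺-empty : (H : UniformHypergraph r n) → edges H ≡ [] → δ⁺ H ≡ 0
δ⁺-empty H none = n≤0⇒n≡0 (subst (δ⁺ H ≤_) (cong length none) (δ⁺≤∣E∣ H))

{-# OPTIONS --safe #-}

-- If N bounds the number of edges through any four vertices, then a triple of vertices lying in
-- more than rN edges meets every edge and every such triple. Replacing one vertex t of an edge
-- through such a triple pqt (two replacements exist by the co-degree condition) has to give a
-- vertex of an edge avoiding p and q, so if pqt lies in very many edges, then so do pqy and pqy′
-- for two further vertices y, y′. Branching over transversals shows that some triple lies in enough
-- edges for this to be iterated twice, and the triples obtained, which meet pairwise, are forced
-- to be the ten triples of a 5-set X. Every edge meets all of them, hence meets X in at least
-- three vertices, and maximality does the rest. The number of edges needed is supplied by
-- comparing with the kernel system of an arbitrary 5-set.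
module Submission where

open import Defs
open import Data.Bool.Properties using () renaming (_≟_ to _≟ᵇ_)
open import Data.Fin using (Fin; zero; suc)
open import Data.Fin.Properties using () renaming (suc-injective to fsuc-injective; _≟_ to _≟ᶠ_)
open import Data.Fin.Subset
  using (Subset; inside; outside; _⊆_; _∩_; _∪_; ∁; ⊥; ⊤; ⁅_⁆; ∣_∣; Nonempty)
  renaming (_∈_ to _∈ₛ_; _∉_ to _∉ₛ_)
open import Data.Fin.Subset.Properties
  using (_∈?_; _⊆?_; nonempty?; ⊆-antisym; ⊆-min; drop-∷-⊆; p⊂q⇒∣p∣<∣q∣; p⊆q⇒∣p∣≤∣q∣;
         ∣⁅x⁆∣≡1; x∈⁅x⁆; x∈⁅y⁆⇒x≡y; x∈p∩q⁺; x∈p∩q⁻; x∈p∪q⁺; x∈p∪q⁻; x∉p⇒x∈∁p; x∈∁p⇒x∉p;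
         p∩q⊆p; p∩q⊆q; p⊆p∪q; q⊆p∪q; ∣∁p∣≡n∸∣p∣; ∉⊥; ∣⊥∣≡0)
open import Data.List
  using (List; []; _∷_; _++_; length; map; filter; concatMap; cartesianProductWith)
open import Data.List.Membership.Propositional using (_∈_; _∉_; find; lose)
open import Data.List.Membership.Propositional.Properties
  using (∈-map⁺; ∈-map⁻; ∈-++⁺ˡ; ∈-++⁺ʳ; ∈-++⁻; ∈-∃++; ∈-filter⁺; ∈-filter⁻; ∈-concatMap⁺;
         ∈-cartesianProductWith⁻)
open import Data.List.Properties using (length-map; length-++; length-filter)
open import Data.List.Relation.Unary.All as All using (All; []; _∷_)
open import Data.List.Relation.Unary.All.Properties as All using (All¬⇒¬Any; ¬Any⇒All¬)
open import Data.List.Relation.Unary.AllPairs using ([]; _∷_)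
open import Data.List.Relation.Unary.Any using (Any; here; there; any?)
open import Data.List.Relation.Unary.Unique.Propositional using (Unique)
import Data.List.Relation.Unary.Unique.Propositional.Properties as Unique
open import Data.Nat
  using (ℕ; zero; suc; _+_; _*_; _^_; _∸_; _≤_; _<_; _≥_; z≤n; s≤s; s≤s⁻¹; >-nonZero)
open import Data.Nat.Combinatorics using (_C_; nC1≡n; nCk+nC[k+1]≡[n+1]C[k+1]; k>n⇒nCk≡0)
open import Data.Nat.Properties
open import Data.Nat.Solver using (module +-*-Solver)
open import Data.Product using (_×_; _,_; ∃-syntax; proj₁; proj₂)
open import Data.Sum using (_⊎_; inj₁; inj₂; [_,_]′)
open import Data.Vec using ([]; _∷_; here; there) renaming (_++_ to _++ᵥ_)
open import Data.Vec.Properties using (∷-injectiveʳ; ≡-dec; ++-injective)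
open import Function using (_∘_; id)
open import Function.Bundles using (mk⇔)
open import Relation.Binary.Definitions using (DecidableEquality)
open import Relation.Binary.PropositionalEquality
  using (_≡_; _≢_; refl; sym; trans; cong; cong₂; subst; ≢-sym; module ≡-Reasoning)
open import Relation.Nullary using (Dec; yes; no; ¬_; ¬?; contradiction)
open import Relation.Nullary.Decidable using (decidable-stable; _×-dec_)

private
  variable
    A B I : Set
    n r   : ℕ

-- Counting with duplicate-free lists.

-- The head of `xs` is struck out of `ys` at one occurrence, and the tail survives in what is left.
-- `ys` may repeat entries, so the union bounds below can take concatenations of overlapping stars
-- for it.
length-mono-⊆ : {xs ys : List A} → Unique xs → (∀ {x} → x ∈ xs → x ∈ ys) → length xs ≤ length ys
length-mono-⊆ {xs = []} _ _ = z≤n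
length-mono-⊆ {xs = x ∷ xs} (x∉xs ∷ u) xs⊆ys with ∈-∃++ (xs⊆ys (here refl))
... | as , bs , refl = begin
  suc (length xs)              ≤⟨ s≤s (length-mono-⊆ u xs⊆as++bs) ⟩
  suc (length (as ++ bs))      ≡⟨ cong suc (length-++ as) ⟩
  suc (length as + length bs)  ≡⟨ +-suc (length as) (length bs) ⟨
  length as + suc (length bs)  ≡⟨ length-++ as ⟨
  length (as ++ x ∷ bs)        ∎
  where
  open ≤-Reasoning
  xs⊆as++bs : ∀ {z} → z ∈ xs → z ∈ as ++ bs
  xs⊆as++bs z∈xs with ∈-++⁻ as (xs⊆ys (there z∈xs))
  ... | inj₁ z∈as         = ∈-++⁺ˡ z∈as
  ... | inj₂ (here refl)  = contradiction refl (All.lookup x∉xs z∈xs)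
  ... | inj₂ (there z∈bs) = ∈-++⁺ʳ as z∈bs

length-concatMap-≤ : (f : I → List A) (is : List I) {B : ℕ} →
                     (∀ {i} → i ∈ is → length (f i) ≤ B) → length (concatMap f is) ≤ length is * B
length-concatMap-≤ f []       _ = z≤n
length-concatMap-≤ f (i ∷ is) b = begin
  length (f i ++ concatMap f is)         ≡⟨ length-++ (f i) ⟩
  length (f i) + length (concatMap f is) ≤⟨ +-mono-≤ (b (here refl)) (length-concatMap-≤ f is (b ∘ there)) ⟩
  _                                      ∎
  where open ≤-Reasoning

pigeonhole : (f : I → List A) (is : List I) {B : ℕ} →
             length is * B < length (concatMap f is) → ∃[ i ] i ∈ is × B < length (f i)
pigeonhole f is {B} many with any? (λ i → B <? length (f i)) is
... | yes large = find large
... | no none   = contradiction many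
  (≤⇒≯ (length-concatMap-≤ f is (λ i∈ → ≮⇒≥ (All.lookup (¬Any⇒All¬ is none) i∈))))

-- Cardinalities of subsets through their lists of elements.

elements : Subset n → List (Fin n)
elements []            = []
elements (inside ∷ S)  = zero ∷ map suc (elements S)
elements (outside ∷ S) = map suc (elements S)

length-elements : (S : Subset n) → length (elements S) ≡ ∣ S ∣
length-elements []            = refl
length-elements (inside ∷ S)  = cong suc (trans (length-map suc (elements S)) (length-elements S))
length-elements (outside ∷ S) = trans (length-map suc (elements S)) (length-elements S)

∈-elements⁺ : {S : Subset n} {x : Fin n} → x ∈ₛ S → x ∈ elements S
∈-elements⁺ {S = inside ∷ S}  here      = here refl
∈-elements⁺ {S = inside ∷ S}  (there p) = there (∈-map⁺ suc (∈-elements⁺ p))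
∈-elements⁺ {S = outside ∷ S} (there p) = ∈-map⁺ suc (∈-elements⁺ p)

∈-elements⁻ : (S : Subset n) {x : Fin n} → x ∈ elements S → x ∈ₛ S
∈-elements⁻ (inside ∷ S) (here refl) = here
∈-elements⁻ (inside ∷ S) (there p) with ∈-map⁻ suc p
... | _ , q , refl = there (∈-elements⁻ S q)
∈-elements⁻ (outside ∷ S) p with ∈-map⁻ suc p
... | _ , q , refl = there (∈-elements⁻ S q)

elements-unique : (S : Subset n) → Unique (elements S)
elements-unique []            = []
elements-unique (inside ∷ S)  =
  All.tabulate (λ p eq → case-zero (subst (_∈ map suc (elements S)) (sym eq) p))
    ∷ Unique.map⁺ fsuc-injective (elements-unique S)
  where
  case-zero : zero ∉ map suc (elements S)
  case-zero p with ∈-map⁻ suc p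
  ... | _ , _ , ()
elements-unique (outside ∷ S) = Unique.map⁺ fsuc-injective (elements-unique S)

length≤∣∣ : {xs : List (Fin n)} (S : Subset n) → Unique xs → All (_∈ₛ S) xs → length xs ≤ ∣ S ∣
length≤∣∣ S u all = subst (_ ≤_) (length-elements S)
  (length-mono-⊆ u (λ x∈ → ∈-elements⁺ (All.lookup all x∈)))

∣∣≤length : (S : Subset n) {xs : List (Fin n)} → (∀ {x} → x ∈ₛ S → x ∈ xs) → ∣ S ∣ ≤ length xs
∣∣≤length S S⊆ = subst (_≤ _) (length-elements S)
  (length-mono-⊆ (elements-unique S) (λ x∈ → S⊆ (∈-elements⁻ S x∈)))

∣∣-subadditive : (S T U : Subset n) → (∀ {x} → x ∈ₛ S → x ∈ₛ T ⊎ x ∈ₛ U) → ∣ S ∣ ≤ ∣ T ∣ + ∣ U ∣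
∣∣-subadditive S T U cover = begin
  ∣ S ∣                                     ≤⟨ ∣∣≤length S S⊆ ⟩
  length (elements T ++ elements U)         ≡⟨ length-++ (elements T) ⟩
  length (elements T) + length (elements U) ≡⟨ cong₂ _+_ (length-elements T) (length-elements U) ⟩
  ∣ T ∣ + ∣ U ∣                             ∎
  where
  open ≤-Reasoning
  S⊆ : ∀ {x} → x ∈ₛ S → x ∈ elements T ++ elements U
  S⊆ x∈ = [ ∈-++⁺ˡ ∘ ∈-elements⁺ , ∈-++⁺ʳ (elements T) ∘ ∈-elements⁺ ]′ (cover x∈)

∣∣-superadditive : (S T U : Subset n) → T ⊆ S → U ⊆ S → (∀ {x} → x ∈ₛ T → x ∉ₛ U) →
                   ∣ T ∣ + ∣ U ∣ ≤ ∣ S ∣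
∣∣-superadditive S T U T⊆S U⊆S disjoint = begin
  ∣ T ∣ + ∣ U ∣                             ≡⟨ cong₂ _+_ (length-elements T) (length-elements U) ⟨
  length (elements T) + length (elements U) ≡⟨ length-++ (elements T) ⟨
  length (elements T ++ elements U)         ≤⟨ length≤∣∣ S unique all ⟩
  ∣ S ∣                                     ∎
  where
  open ≤-Reasoning
  unique : Unique (elements T ++ elements U)
  unique = Unique.++⁺ (elements-unique T) (elements-unique U)
    (λ (x∈T , x∈U) → disjoint (∈-elements⁻ T x∈T) (∈-elements⁻ U x∈U))
  all : All (_∈ₛ S) (elements T ++ elements U)
  all = All.tabulate λ x∈ → [ T⊆S ∘ ∈-elements⁻ T , U⊆S ∘ ∈-elements⁻ U ]′ (∈-++⁻ (elements T) x∈)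

⊆∧∣∣≤⇒≡ : {S T : Subset n} → S ⊆ T → ∣ T ∣ ≤ ∣ S ∣ → S ≡ T
⊆∧∣∣≤⇒≡ {S = S} {T} S⊆T T≤S = ⊆-antisym S⊆T λ {x} x∈T → decidable-stable (x ∈? S)
  λ x∉S → contradiction (p⊂q⇒∣p∣<∣q∣ (S⊆T , x , x∈T , x∉S)) (≤⇒≯ T≤S)

fromList : List (Fin n) → Subset n
fromList []       = ⊥
fromList (x ∷ xs) = ⁅ x ⁆ ∪ fromList xs

∈-fromList⁺ : {xs : List (Fin n)} {x : Fin n} → x ∈ xs → x ∈ₛ fromList xs
∈-fromList⁺ (here refl) = x∈p∪q⁺ (inj₁ (x∈⁅x⁆ _))
∈-fromList⁺ (there p)   = x∈p∪q⁺ (inj₂ (∈-fromList⁺ p))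

∈-fromList⁻ : (xs : List (Fin n)) {x : Fin n} → x ∈ₛ fromList xs → x ∈ xs
∈-fromList⁻ []       p = contradiction p ∉⊥
∈-fromList⁻ (y ∷ ys) p with x∈p∪q⁻ ⁅ y ⁆ (fromList ys) p
... | inj₁ q = here (x∈⁅y⁆⇒x≡y y q)
... | inj₂ q = there (∈-fromList⁻ ys q)

∣fromList∣ : {xs : List (Fin n)} → Unique xs → ∣ fromList xs ∣ ≡ length xs
∣fromList∣ {xs = xs} u = ≤-antisym (∣∣≤length _ (∈-fromList⁻ xs))
  (length≤∣∣ _ u (All.tabulate ∈-fromList⁺))

-- Removing and exchanging a vertex.

infixl 5 _∖_

_∖_ : Subset n → Fin n → Subset n
E ∖ t = E ∩ ∁ ⁅ t ⁆

∈-∖⁺ : {E : Subset n} {x t : Fin n} → x ∈ₛ E → x ≢ t → x ∈ₛ E ∖ t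
∈-∖⁺ {t = t} x∈E x≢t = x∈p∩q⁺ (x∈E , x∉p⇒x∈∁p (λ x∈t → x≢t (x∈⁅y⁆⇒x≡y t x∈t)))

∈-∖⁻ : (E : Subset n) {x t : Fin n} → x ∈ₛ E ∖ t → x ∈ₛ E × x ≢ t
∈-∖⁻ E {t = t} x∈ with x∈p∩q⁻ E (∁ ⁅ t ⁆) x∈
... | x∈E , x∈∁t = x∈E , λ { refl → x∈∁p⇒x∉p x∈∁t (x∈⁅x⁆ t) }

∣∖∣ : (E : Subset n) {t : Fin n} → t ∈ₛ E → suc ∣ E ∖ t ∣ ≡ ∣ E ∣
∣∖∣ E {t} t∈E = trans (sym (trans (cong (∣ E ∖ t ∣ +_) (∣⁅x⁆∣≡1 t)) (+-comm ∣ E ∖ t ∣ 1)))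
  (≤-antisym
    (∣∣-superadditive E (E ∖ t) ⁅ t ⁆ (p∩q⊆p E _)
      (λ p → subst (_∈ₛ E) (sym (x∈⁅y⁆⇒x≡y t p)) t∈E)
      (λ p q → proj₂ (∈-∖⁻ E p) (x∈⁅y⁆⇒x≡y t q)))
    (∣∣-subadditive E (E ∖ t) ⁅ t ⁆ split))
  where
  split : ∀ {x} → x ∈ₛ E → x ∈ₛ E ∖ t ⊎ x ∈ₛ ⁅ t ⁆
  split {x} x∈E with x ∈? ⁅ t ⁆
  ... | yes p = inj₂ p
  ... | no ¬p = inj₁ (x∈p∩q⁺ (x∈E , x∉p⇒x∈∁p ¬p))

∣∪⁅⁆∣ : (S : Subset n) {y : Fin n} → y ∉ₛ S → ∣ S ∪ ⁅ y ⁆ ∣ ≡ suc ∣ S ∣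
∣∪⁅⁆∣ S {y} y∉S = trans (≤-antisym
    (∣∣-subadditive (S ∪ ⁅ y ⁆) S ⁅ y ⁆ (x∈p∪q⁻ S ⁅ y ⁆))
    (∣∣-superadditive (S ∪ ⁅ y ⁆) S ⁅ y ⁆ (x∈p∪q⁺ ∘ inj₁) (x∈p∪q⁺ ∘ inj₂)
      (λ p q → y∉S (subst (_∈ₛ S) (x∈⁅y⁆⇒x≡y y q) p))))
  (trans (cong (∣ S ∣ +_) (∣⁅x⁆∣≡1 y)) (+-comm ∣ S ∣ 1))

swap : Subset n → Fin n → Fin n → Subset n
swap E t y = (E ∖ t) ∪ ⁅ y ⁆

swap-new : (E : Subset n) (t y : Fin n) → y ∈ₛ swap E t y
swap-new E t y = x∈p∪q⁺ (inj₂ (x∈⁅x⁆ y))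

swap-old : {E : Subset n} {x t : Fin n} (y : Fin n) → x ∈ₛ E → x ≢ t → x ∈ₛ swap E t y
swap-old y x∈E x≢t = x∈p∪q⁺ (inj₁ (∈-∖⁺ x∈E x≢t))

swap⁻ : (E : Subset n) (t y : Fin n) {x : Fin n} → x ∈ₛ swap E t y → (x ∈ₛ E × x ≢ t) ⊎ x ≡ y
swap⁻ E t y x∈ with x∈p∪q⁻ (E ∖ t) ⁅ y ⁆ x∈
... | inj₁ p = inj₁ (∈-∖⁻ E p)
... | inj₂ p = inj₂ (x∈⁅y⁆⇒x≡y y p)

-- Lets `shift` recover an edge from its swapped version, so that edges through the old vertex are
-- counted by edges through the new one.
swap-swap : {E : Subset n} {t y : Fin n} → t ∈ₛ E → y ∉ₛ E → swap (swap E t y) y t ≡ E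
swap-swap {E = E} {t} {y} t∈E y∉E = ⊆-antisym to from
  where
  to : swap (swap E t y) y t ⊆ E
  to p with swap⁻ (swap E t y) y t p
  ... | inj₂ refl = t∈E
  ... | inj₁ (q , x≢y) with swap⁻ E t y q
  ...   | inj₁ (x∈E , _) = x∈E
  ...   | inj₂ x≡y       = contradiction x≡y x≢y
  from : E ⊆ swap (swap E t y) y t
  from {x} x∈E with x ∈? ⁅ t ⁆
  ... | yes p = x∈p∪q⁺ (inj₂ p)
  ... | no ¬p = swap-old t (swap-old y x∈E (λ { refl → ¬p (x∈⁅x⁆ t) })) (λ { refl → y∉E x∈E })

-- Enumeration of the supersets of a given size.

-- `j` is the number of vertices added to the given set. The recursion follows Pascal's rule, so the
-- length is a binomial coefficient.
supersets : Subset n → ℕ → List (Subset n)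
supersets []            zero    = [] ∷ []
supersets []            (suc j) = []
supersets (inside ∷ S)  j       = map (inside ∷_) (supersets S j)
supersets (outside ∷ S) zero    = map (outside ∷_) (supersets S zero)
supersets (outside ∷ S) (suc j) =
  map (inside ∷_) (supersets S j) ++ map (outside ∷_) (supersets S (suc j))

length-supersets : (S : Subset n) (j : ℕ) → length (supersets S j) ≡ ∣ ∁ S ∣ C j
length-supersets []            zero    = refl
length-supersets []            (suc j) = sym (k>n⇒nCk≡0 {0} {suc j} (s≤s z≤n))
length-supersets (inside ∷ S)  j       =
  trans (length-map (inside ∷_) (supersets S j)) (length-supersets S j)
length-supersets (outside ∷ S) zero    =
  trans (length-map (outside ∷_) (supersets S zero)) (length-supersets S zero)
length-supersets (outside ∷ S) (suc j) = begin
  length (map (inside ∷_) (supersets S j) ++ map (outside ∷_) (supersets S (suc j)))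
    ≡⟨ length-++ (map (inside ∷_) (supersets S j)) ⟩
  length (map (inside ∷_) (supersets S j)) + length (map (outside ∷_) (supersets S (suc j)))
    ≡⟨ cong₂ _+_ (trans (length-map (inside ∷_) (supersets S j)) (length-supersets S j))
                 (trans (length-map (outside ∷_) (supersets S (suc j))) (length-supersets S (suc j))) ⟩
  ∣ ∁ S ∣ C j + ∣ ∁ S ∣ C suc j
    ≡⟨ nCk+nC[k+1]≡[n+1]C[k+1] ∣ ∁ S ∣ j ⟩
  suc ∣ ∁ S ∣ C suc j ∎
  where open ≡-Reasoning

supersets-unique : (S : Subset n) (j : ℕ) → Unique (supersets S j)
supersets-unique []            zero    = [] ∷ []
supersets-unique []            (suc j) = []
supersets-unique (inside ∷ S)  j       = Unique.map⁺ ∷-injectiveʳ (supersets-unique S j)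
supersets-unique (outside ∷ S) zero    = Unique.map⁺ ∷-injectiveʳ (supersets-unique S zero)
supersets-unique (outside ∷ S) (suc j) = Unique.++⁺
  (Unique.map⁺ ∷-injectiveʳ (supersets-unique S j))
  (Unique.map⁺ ∷-injectiveʳ (supersets-unique S (suc j)))
  disjoint
  where
  disjoint : ∀ {E} → ¬ (E ∈ map (inside ∷_) (supersets S j) × E ∈ map (outside ∷_) (supersets S (suc j)))
  disjoint (p , q) with ∈-map⁻ (inside ∷_) p | ∈-map⁻ (outside ∷_) q
  ... | _ , _ , refl | _ , _ , ()

∈-supersets⁻ : (S : Subset n) (j : ℕ) {E : Subset n} → E ∈ supersets S j → ∣ E ∣ ≡ j + ∣ S ∣
∈-supersets⁻ []            zero    (here refl) = refl
∈-supersets⁻ (inside ∷ S)  j       p with ∈-map⁻ (inside ∷_) p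
... | _ , q , refl = trans (cong suc (∈-supersets⁻ S j q)) (sym (+-suc j ∣ S ∣))
∈-supersets⁻ (outside ∷ S) zero    p with ∈-map⁻ (outside ∷_) p
... | _ , q , refl = ∈-supersets⁻ S zero q
∈-supersets⁻ (outside ∷ S) (suc j) p with ∈-++⁻ (map (inside ∷_) (supersets S j)) p
... | inj₁ q with ∈-map⁻ (inside ∷_) q
...   | _ , q′ , refl = cong suc (∈-supersets⁻ S j q′)
∈-supersets⁻ (outside ∷ S) (suc j) p | inj₂ q with ∈-map⁻ (outside ∷_) q
...   | _ , q′ , refl = ∈-supersets⁻ S (suc j) q′

∈-supersets⁺ : (S : Subset n) (j : ℕ) {E : Subset n} → S ⊆ E → ∣ E ∣ ≡ j + ∣ S ∣ → E ∈ supersets S j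
∈-supersets⁺ []            zero    {[]}          _   _  = here refl
∈-supersets⁺ []            (suc j) {[]}          _   ()
∈-supersets⁺ (inside ∷ S)  j       {outside ∷ E} S⊆E _ with S⊆E here
... | ()
∈-supersets⁺ (inside ∷ S)  j       {inside ∷ E}  S⊆E eq =
  ∈-map⁺ (inside ∷_) (∈-supersets⁺ S j (drop-∷-⊆ S⊆E) (suc-injective (trans eq (+-suc j ∣ S ∣))))
∈-supersets⁺ (outside ∷ S) zero    {outside ∷ E} S⊆E eq =
  ∈-map⁺ (outside ∷_) (∈-supersets⁺ S zero (drop-∷-⊆ S⊆E) eq)
∈-supersets⁺ (outside ∷ S) zero    {inside ∷ E}  S⊆E eq =
  contradiction (p⊆q⇒∣p∣≤∣q∣ (drop-∷-⊆ S⊆E)) (<⇒≱ (≤-reflexive eq))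
∈-supersets⁺ (outside ∷ S) (suc j) {inside ∷ E}  S⊆E eq =
  ∈-++⁺ˡ (∈-map⁺ (inside ∷_) (∈-supersets⁺ S j (drop-∷-⊆ S⊆E) (cong (_∸ 1) eq)))
∈-supersets⁺ (outside ∷ S) (suc j) {outside ∷ E} S⊆E eq =
  ∈-++⁺ʳ (map (inside ∷_) (supersets S j))
    (∈-map⁺ (outside ∷_) (∈-supersets⁺ S (suc j) (drop-∷-⊆ S⊆E) eq))

-- Replacing one vertex of an edge.

-- `E ∖ t` lies in at least three edges, so in one other than `E` and `swap E t w`. That edge has
-- one vertex `y` more than `E ∖ t`, and being different from those two it has `y ∉ₛ E` and `y ≢ w`.
swap-edge : (H : UniformHypergraph r n) → PositiveCodegrees≥ H 3 →
            ∀ {E t} → E ∈ edges H → t ∈ₛ E → (w : Fin n) →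
            ∃[ y ] y ∉ₛ E × y ≢ w × swap E t y ∈ edges H
swap-edge {r = r} H codeg {E} {t} E∈H t∈E w = choose (any? fresh? containing)
  where
  S = E ∖ t
  containing = filter (S ⊆?_) (edges H)
  fresh? = λ F → ¬? (≡-dec _≟ᵇ_ F E) ×-dec ¬? (≡-dec _≟ᵇ_ F (swap E t w))
  ∣E∣ : ∣ E ∣ ≡ r
  ∣E∣ = All.lookup (uniform H) E∈H
  ∣S∣ : ∣ S ∣ ≡ r ∸ 1
  ∣S∣ = cong (_∸ 1) (trans (∣∖∣ E t∈E) ∣E∣)
  covered : ¬ Any (λ F → F ≢ E × F ≢ swap E t w) containing →
            ∀ {F} → F ∈ containing → F ∈ E ∷ swap E t w ∷ []
  covered none {F} F∈ with ≡-dec _≟ᵇ_ F E | ≡-dec _≟ᵇ_ F (swap E t w)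
  ... | yes F≡E | _       = here F≡E
  ... | no _    | yes F≡w = there (here F≡w)
  ... | no F≢E  | no F≢w  = contradiction (lose F∈ (F≢E , F≢w)) none
  new : ∀ {F} → F ∈ edges H → S ⊆ F → F ≢ E → F ≢ swap E t w → Dec (Nonempty (F ∩ ∁ S)) →
        ∃[ y ] y ∉ₛ E × y ≢ w × swap E t y ∈ edges H
  new {F} F∈H S⊆F F≢E F≢w = pick
    where
    ∣F∣ : ∣ F ∣ ≡ r
    ∣F∣ = All.lookup (uniform H) F∈H
    ∣F∣≡1+∣S∣ : ∣ F ∣ ≡ suc ∣ S ∣
    ∣F∣≡1+∣S∣ = trans ∣F∣ (sym (trans (∣∖∣ E t∈E) ∣E∣))
    pick : Dec (Nonempty (F ∩ ∁ S)) → ∃[ y ] y ∉ₛ E × y ≢ w × swap E t y ∈ edges H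
    pick (no empty) = contradiction (p⊆q⇒∣p∣≤∣q∣ F⊆S) (<⇒≱ (≤-reflexive (sym ∣F∣≡1+∣S∣)))
      where
      F⊆S : F ⊆ S
      F⊆S {x} x∈F = decidable-stable (x ∈? S) λ x∉S →
        empty (x , x∈p∩q⁺ (x∈F , x∉p⇒x∈∁p x∉S))
    pick (yes (y , y∈)) = y , y∉E , y≢w , subst (_∈ edges H) (sym swap≡F) F∈H
      where
      y∈F : y ∈ₛ F
      y∈F = p∩q⊆p F (∁ S) y∈
      y∉S : y ∉ₛ S
      y∉S = x∈∁p⇒x∉p (p∩q⊆q F (∁ S) y∈)
      swap≡F : swap E t y ≡ F
      swap≡F = ⊆∧∣∣≤⇒≡
        (λ x∈ → [ S⊆F , (λ x∈y → subst (_∈ₛ F) (sym (x∈⁅y⁆⇒x≡y y x∈y)) y∈F) ]′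
          (x∈p∪q⁻ S ⁅ y ⁆ x∈))
        (≤-reflexive (trans ∣F∣≡1+∣S∣ (sym (∣∪⁅⁆∣ S y∉S))))
      y≢w : y ≢ w
      y≢w refl = F≢w (sym swap≡F)
      E⊆F : t ∈ₛ F → E ⊆ F
      E⊆F t∈F {x} x∈E with x ≟ᶠ t
      ... | yes refl = t∈F
      ... | no x≢t   = S⊆F (∈-∖⁺ x∈E x≢t)
      y≢t : y ≢ t
      y≢t refl = F≢E (sym (⊆∧∣∣≤⇒≡ (E⊆F y∈F) (≤-reflexive (trans ∣F∣ (sym ∣E∣)))))
      y∉E : y ∉ₛ E
      y∉E y∈E = y∉S (∈-∖⁺ y∈E y≢t)
  choose : Dec (Any (λ F → F ≢ E × F ≢ swap E t w) containing) →
           ∃[ y ] y ∉ₛ E × y ≢ w × swap E t y ∈ edges H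
  choose (no none) = contradiction
    (length-mono-⊆ (Unique.filter⁺ (S ⊆?_) (distinct H)) (covered none))
    (<⇒≱ (codeg S ∣S∣ (lose E∈H (p∩q⊆p E _))))
  choose (yes some) =
    let F , F∈ , F≢E , F≢w = find some
        F∈H , S⊆F = ∈-filter⁻ (S ⊆?_) {xs = edges H} F∈
    in new F∈H S⊆F F≢E F≢w (nonempty? (F ∩ ∁ S))

-- Stars, degrees and heavy triples.

module _ (H : UniformHypergraph r n) where

  star : List (Fin n) → List (Subset n)
  star T = filter (λ E → All.all? (_∈? E) T) (edges H)

  deg : List (Fin n) → ℕ
  deg T = length (star T)

  star-unique : (T : List (Fin n)) → Unique (star T)
  star-unique T = Unique.filter⁺ (λ E → All.all? (_∈? E) T) (distinct H)

  ∈-star⁺ : ∀ {T E} → E ∈ edges H → All (_∈ₛ E) T → E ∈ star T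
  ∈-star⁺ {T} = ∈-filter⁺ (λ E → All.all? (_∈? E) T)

  ∈-star⁻ : ∀ T {E} → E ∈ star T → E ∈ edges H × All (_∈ₛ E) T
  ∈-star⁻ T = ∈-filter⁻ (λ E → All.all? (_∈? E) T) {xs = edges H}

  Transversal : List (Fin n) → Set
  Transversal S = ∀ {E} → E ∈ edges H → Any (_∈ₛ E) S

  Distinct : Fin n → Fin n → Fin n → Set
  Distinct a b c = a ≢ b × a ≢ c × b ≢ c

  record Heavy (B : ℕ) (a b c : Fin n) : Set where
    constructor _,_
    field
      distinct-vertices : Distinct a b c
      large-degree      : B < deg (a ∷ b ∷ c ∷ [])

-- Two steps of `B ↦ r * N + r * B` starting from `r * N`: what a triple needs for two successive
-- applications of `shift` to end above `r * N`.
threshold : ℕ → ℕ → ℕ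
threshold r N = r * N + r * (r * N + r * (r * N))

module Swapping
  (H : UniformHypergraph r n) (inter : Intersecting H) (codeg : PositiveCodegrees≥ H 3)
  {E₀ : Subset n} (E₀∈H : E₀ ∈ edges H)
  (3≤r : 3 ≤ r)
  {N : ℕ} (deg₄ : ∀ {T : List (Fin n)} → Unique T → length T ≡ 4 → deg H T ≤ N)
  where

  deg-antitone : ∀ {S T} → (∀ {x} → x ∈ S → x ∈ T) → deg H T ≤ deg H S
  deg-antitone {S} {T} S⊆T = length-mono-⊆ (star-unique H T) λ E∈ →
    let E∈H , T⊆E = ∈-star⁻ H T E∈ in ∈-star⁺ H E∈H (All.tabulate (All.lookup T⊆E ∘ S⊆T))

  length-edge : ∀ {E} → E ∈ edges H → length (elements E) ≡ r
  length-edge {E} E∈H = trans (length-elements E) (All.lookup (uniform H) E∈H)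

  elements-transversal : ∀ {F} → F ∈ edges H → Transversal H (elements F)
  elements-transversal {F} F∈H E∈H with inter F∈H E∈H
  ... | x , x∈ = let x∈F , x∈E = x∈p∩q⁻ F _ x∈ in lose (∈-elements⁺ x∈F) x∈E

  -- First `a` is swapped out of `E₀`, then `b` is swapped out for a vertex other than `a`.
  avoid : (a b : Fin n) → ∃[ E ] E ∈ edges H × a ∉ₛ E × b ∉ₛ E
  avoid a b = avoid₂ avoid₁
    where
    avoid₁ : ∃[ E ] E ∈ edges H × a ∉ₛ E
    avoid₁ with a ∈? E₀
    ... | no a∉E₀ = E₀ , E₀∈H , a∉E₀
    ... | yes a∈E₀ with swap-edge H codeg E₀∈H a∈E₀ a
    ...   | y , _ , y≢a , E∈H = _ , E∈H ,
      λ p → [ (λ (_ , a≢a) → a≢a refl) , ≢-sym y≢a ]′ (swap⁻ E₀ a y p)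
    avoid₂ : ∃[ E ] E ∈ edges H × a ∉ₛ E → ∃[ E ] E ∈ edges H × a ∉ₛ E × b ∉ₛ E
    avoid₂ (E , E∈H , a∉E) with b ∈? E
    ... | no b∉E = E , E∈H , a∉E , b∉E
    ... | yes b∈E with swap-edge H codeg E∈H b∈E a
    ...   | y , y∉E , y≢a , E′∈H = _ , E′∈H ,
      (λ p → [ (λ (a∈E , _) → a∉E a∈E) , ≢-sym y≢a ]′ (swap⁻ E b y p)) ,
      (λ p → [ (λ (_ , b≢b) → b≢b refl) , (λ { refl → y∉E b∈E }) ]′ (swap⁻ E b y p))

  -- Every edge through `S` meets the transversal `F`, so the stars of `x ∷ S` with `x` in `F` cover
  -- the star of `S`.
  branch : ∀ {B} S {F} → Transversal H F → length F * B < deg H S →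
           ∃[ x ] x ∈ F × B < deg H (x ∷ S)
  branch S {F} trans-F many = pigeonhole (λ x → star H (x ∷ S)) F (<-≤-trans many
    (length-mono-⊆ (star-unique H S) λ E∈ →
      let E∈H , S⊆E = ∈-star⁻ H S E∈
          x , x∈F , x∈E = find (trans-F E∈H)
      in ∈-concatMap⁺ (λ x → star H (x ∷ S)) (lose x∈F (∈-star⁺ H E∈H (x∈E ∷ S⊆E)))))

  -- Branches over an edge missing `a` and `b`, so that the new vertex differs from both.
  branch-avoiding : ∀ {B} a b S → r * B < deg H S → ∃[ x ] x ≢ a × x ≢ b × B < deg H (x ∷ S)
  branch-avoiding {B} a b S many with avoid a b
  ... | F , F∈H , a∉F , b∉F
    with branch S (elements-transversal F∈H) (subst (λ k → k * B < deg H S) (sym (length-edge F∈H)) many)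
  ...   | x , x∈ , large = x , (λ { refl → a∉F (∈-elements⁻ F x∈) }) ,
                               (λ { refl → b∉F (∈-elements⁻ F x∈) }) , large

  rotate : ∀ {B a b c} → Heavy H B a b c → Heavy H B b c a
  rotate ((a≢b , a≢c , b≢c) , large) = (b≢c , ≢-sym a≢b , ≢-sym a≢c) ,
    <-≤-trans large (deg-antitone λ
      { (here p) → there (here p) ; (there (here p)) → there (there (here p))
      ; (there (there (here p))) → here p })

  transpose : ∀ {B a b c} → Heavy H B a b c → Heavy H B b a c
  transpose ((a≢b , a≢c , b≢c) , large) = (≢-sym a≢b , b≢c , a≢c) ,
    <-≤-trans large (deg-antitone λ
      { (here p) → there (here p) ; (there (here p)) → here p
      ; (there (there (here p))) → there (there (here p)) })

  weaken : ∀ {B B′ a b c} → B′ ≤ B → Heavy H B a b c → Heavy H B′ a b c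
  weaken B′≤B (d , large) = d , ≤-<-trans B′≤B large

  deg₄-distinct : ∀ {x a b c} → Distinct H a b c → x ≢ a → x ≢ b → x ≢ c →
                  deg H (x ∷ a ∷ b ∷ c ∷ []) ≤ N
  deg₄-distinct (a≢b , a≢c , b≢c) x≢a x≢b x≢c =
    deg₄ ((x≢a ∷ x≢b ∷ x≢c ∷ []) ∷ (a≢b ∷ a≢c ∷ []) ∷ (b≢c ∷ []) ∷ [] ∷ []) refl

  -- If `S` missed the triple, every edge through the triple would contain a fourth vertex from `S`.
  -- There are at most `r` choices for it, with at most `N` edges each.
  meets : ∀ {a b c S} → Heavy H (r * N) a b c → Transversal H S → length S ≤ r →
          Any (_∈ a ∷ b ∷ c ∷ []) S
  meets {a} {b} {c} {S} (dist , large) trans-S ∣S∣≤r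
    with any? (λ x → any? (x ≟ᶠ_) (a ∷ b ∷ c ∷ [])) S
  ... | yes p   = p
  ... | no none = contradiction large (≤⇒≯ (begin
    deg H T                                      ≤⟨ length-mono-⊆ (star-unique H T) covered ⟩
    length (concatMap (λ x → star H (x ∷ T)) S)  ≤⟨ length-concatMap-≤ (λ x → star H (x ∷ T)) S small ⟩
    length S * N                                 ≤⟨ *-monoˡ-≤ N ∣S∣≤r ⟩
    r * N                                        ∎))
    where
    open ≤-Reasoning
    T = a ∷ b ∷ c ∷ []
    covered : ∀ {E} → E ∈ star H T → E ∈ concatMap (λ x → star H (x ∷ T)) S
    covered E∈ =
      let E∈H , T⊆E = ∈-star⁻ H T E∈
          x , x∈S , x∈E = find (trans-S E∈H)
      in ∈-concatMap⁺ (λ x → star H (x ∷ T)) (lose x∈S (∈-star⁺ H E∈H (x∈E ∷ T⊆E)))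
    small : ∀ {x} → x ∈ S → deg H (x ∷ T) ≤ N
    small x∈S = deg₄-distinct dist
      (λ p → none (lose x∈S (here p)))
      (λ p → none (lose x∈S (there (here p))))
      (λ p → none (lose x∈S (there (there (here p)))))

  -- By intersection an edge is a transversal of size `r`, so `meets` applies to it. Consequently a
  -- heavy triple can serve as a branching set of size 3 in place of an edge.
  heavy-transversal : ∀ {a b c} → Heavy H (r * N) a b c → Transversal H (a ∷ b ∷ c ∷ [])
  heavy-transversal heavy {E} E∈H
    with find (meets heavy (elements-transversal E∈H) (≤-reflexive (length-edge E∈H)))
  ... | x , x∈E , x∈T = lose x∈T (∈-elements⁻ E x∈E)

  -- Fix an edge `F` missing `p` and `q`. In each edge through `p`, `q`, `t` exchange `t` for some
  -- `y ≢ w`; the result meets `F`. Meeting it in an old vertex means that the edge had a fourth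
  -- vertex in `F`, which accounts for at most `r * N` edges. The other edges have `y` in `F`, and
  -- some `y` receives more than `B` of them.
  shift : ∀ {B p q t} → Heavy H (r * N + r * B) p q t → (w : Fin n) →
          ∃[ y ] y ≢ w × y ≢ t × Heavy H B p q y
  shift {B} {p} {q} {t} (dist@(p≢q , p≢t , q≢t) , large) w with avoid p q
  ... | F , F∈H , p∉F , q∉F
    with pigeonhole moved F₂ (≤-<-trans (*-monoˡ-≤ B ∣F₂∣≤r) moved-large)
    where
    T = p ∷ q ∷ t ∷ []
    ≢t? = λ x → ¬? (x ≟ᶠ t)
    ≢tw? = λ y → ¬? (y ≟ᶠ t) ×-dec ¬? (y ≟ᶠ w)
    F₁ = filter ≢t? (elements F)
    -- The replacement vertex is never `t` or `w`, so nothing is lost by leaving them out, and the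
    -- `y` found differs from both.
    F₂ = filter ≢tw? (elements F)
    kept moved : Fin n → List (Subset n)
    kept x = star H (x ∷ T)
    moved y = map (λ E → swap E y t) (star H (p ∷ q ∷ y ∷ []))
    ∣F₁∣≤r : length F₁ ≤ r
    ∣F₁∣≤r = ≤-trans (length-filter ≢t? (elements F)) (≤-reflexive (length-edge F∈H))
    ∣F₂∣≤r : length F₂ ≤ r
    ∣F₂∣≤r = ≤-trans (length-filter ≢tw? (elements F)) (≤-reflexive (length-edge F∈H))
    ∉F⇒≢ : ∀ {x z} → x ∈ elements F → z ∉ₛ F → x ≢ z
    ∉F⇒≢ x∈F z∉F refl = z∉F (∈-elements⁻ F x∈F)
    kept-small : length (concatMap kept F₁) ≤ r * N
    kept-small = ≤-trans
      (length-concatMap-≤ kept F₁ λ x∈F₁ → let x∈F , x≢t = ∈-filter⁻ ≢t? {xs = elements F} x∈F₁ in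
        deg₄-distinct dist (∉F⇒≢ x∈F p∉F) (∉F⇒≢ x∈F q∉F) x≢t)
      (*-monoˡ-≤ N ∣F₁∣≤r)
    covered : ∀ {E} → E ∈ star H T → E ∈ concatMap kept F₁ ++ concatMap moved F₂
    covered {E} E∈ with ∈-star⁻ H T E∈
    ... | E∈H , T⊆E@(p∈E ∷ q∈E ∷ t∈E ∷ []) with swap-edge H codeg E∈H t∈E w
    ...   | y , y∉E , y≢w , E′∈H with inter F∈H E′∈H
    ...     | x , x∈ with x∈p∩q⁻ F (swap E t y) x∈
    ...       | x∈F , x∈E′ with swap⁻ E t y x∈E′
    ...         | inj₁ (x∈E , x≢t) = ∈-++⁺ˡ (∈-concatMap⁺ kept
      (lose (∈-filter⁺ ≢t? (∈-elements⁺ x∈F) x≢t) (∈-star⁺ H E∈H (x∈E ∷ T⊆E))))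
    -- Here `F` meets the swapped edge in the new vertex, and the original edge is the image of the
    -- swapped one under the reverse exchange.
    ...         | inj₂ refl = ∈-++⁺ʳ (concatMap kept F₁) (∈-concatMap⁺ moved
      (lose (∈-filter⁺ ≢tw? (∈-elements⁺ x∈F) ((λ { refl → y∉E t∈E }) , y≢w))
        (subst (_∈ moved y) (swap-swap t∈E y∉E)
          (∈-map⁺ (λ E → swap E y t) (∈-star⁺ H E′∈H
            (swap-old y p∈E p≢t ∷ swap-old y q∈E q≢t ∷ swap-new E t y ∷ []))))))
    moved-large : r * B < length (concatMap moved F₂)
    moved-large = +-cancelˡ-< (r * N) _ _ (begin-strict
      r * N + r * B                                            <⟨ large ⟩
      deg H T                                                  ≤⟨ length-mono-⊆ (star-unique H T) covered ⟩
      length (concatMap kept F₁ ++ concatMap moved F₂)          ≡⟨ length-++ (concatMap kept F₁) ⟩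
      length (concatMap kept F₁) + length (concatMap moved F₂)  ≤⟨ +-monoˡ-≤ _ kept-small ⟩
      r * N + length (concatMap moved F₂)                      ∎)
      where open ≤-Reasoning
  ... | y , y∈F₂ , y-large with ∈-filter⁻ (λ y → ¬? (y ≟ᶠ t) ×-dec ¬? (y ≟ᶠ w)) {xs = elements F} y∈F₂
  ...   | y∈F , y≢t , y≢w = y , y≢w , y≢t ,
    (p≢q , (λ { refl → p∉F (∈-elements⁻ F y∈F) }) , (λ { refl → q∉F (∈-elements⁻ F y∈F) })) ,
    subst (B <_) (length-map (λ E → swap E y t) (star H (p ∷ q ∷ y ∷ []))) y-large

  -- Finding heavier and heavier triples.

  ∣H∣≤deg[] : ∣E H ∣ ≤ deg H []
  ∣H∣≤deg[] = length-mono-⊆ (distinct H) (λ E∈H → ∈-star⁺ H E∈H [])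

  extend₂ : ∀ {B x y} → y ≢ x → r * B < deg H (y ∷ x ∷ []) → ∃[ z ] Heavy H B z y x
  extend₂ {x = x} {y} y≢x large =
    let z , z≢y , z≢x , large′ = branch-avoiding y x (y ∷ x ∷ []) large
    in z , (z≢y , z≢x , y≢x) , large′

  extend₁ : ∀ {B x} → r * (r * B) < deg H (x ∷ []) → ∃[ z ] ∃[ y ] Heavy H B z y x
  extend₁ {x = x} large =
    let y , y≢x , _ , large′ = branch-avoiding x x (x ∷ []) large
        z , heavy = extend₂ y≢x large′
    in z , y , heavy

  SomeHeavy : ℕ → Set
  SomeHeavy B = ∃[ a ] ∃[ b ] ∃[ c ] Heavy H B a b c

  -- Three branchings over edges, at the cost of a factor `r` each.
  some-heavy : ∀ {B} → r * (r * (r * B)) < ∣E H ∣ → SomeHeavy B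
  some-heavy {B} large =
    let x , _ , large′ = branch [] (elements-transversal E₀∈H)
          (subst (λ k → k * (r * (r * B)) < deg H []) (sym (length-edge E₀∈H))
            (<-≤-trans large ∣H∣≤deg[]))
        z , y , heavy = extend₁ large′
    in z , y , x , heavy

  -- A heavy triple as the first branching set lowers one factor `r` to 3.
  heavier : ∀ {B a b c} → Heavy H (r * N) a b c → 3 * (r * (r * B)) < ∣E H ∣ → SomeHeavy B
  heavier {B} heavy large =
    let x , _ , large′ = branch {r * (r * B)} [] (heavy-transversal heavy) (<-≤-trans large ∣H∣≤deg[])
        z , y , heavy′ = extend₁ large′
    in z , y , x , heavy′

  -- Two factors are lowered to 3. The second branching must avoid the vertex `x` chosen first, so
  -- `x` is shifted out of the heavy triple; what results is still transversal.
  heaviest : ∀ {B a b c} → Heavy H (r * N + r * (r * N)) a b c → 3 * (3 * (r * B)) < ∣E H ∣ → SomeHeavy B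
  heaviest {B} {a} {b} {c} heavy large =
    let x , x∈ , large′ = branch {3 * (r * B)} [] (heavy-transversal (weaken (m≤m+n (r * N) _) heavy))
                            (<-≤-trans large ∣H∣≤deg[])
    in through large′ (last x∈)
    where
    last : ∀ {x} → x ∈ a ∷ b ∷ c ∷ [] → ∃[ p ] ∃[ q ] Heavy H (r * N + r * (r * N)) p q x
    last (here refl)                 = b , c , rotate heavy
    last (there (here refl))         = c , a , rotate (rotate heavy)
    last (there (there (here refl))) = a , b , heavy
    through : ∀ {x} → 3 * (r * B) < deg H (x ∷ []) →
              ∃[ p ] ∃[ q ] Heavy H (r * N + r * (r * N)) p q x → SomeHeavy B
    through {x} large (p , q , heavy@((_ , p≢x , q≢x) , _)) =
      let y , y≢x , _ , heavy′ = shift {r * N} heavy x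
          z , z∈ , large′ = branch {r * B} (x ∷ []) (heavy-transversal heavy′) large
          u , heavy″ = extend₂ (All.lookup {P = _≢ x} (p≢x ∷ q≢x ∷ y≢x ∷ []) z∈) large′
      in u , z , x , heavy″

  -- The five-set spanned by heavy triples.

  -- By shift, B₀-heavy triples yield B₁-heavy ones and these yield B₂-heavy ones, which are
  -- transversal by heavy-transversal.
  B₂ B₁ B₀ : ℕ
  B₂ = r * N
  B₁ = r * N + r * B₂
  B₀ = threshold r N

  -- `meets` gives a common vertex of the two triples, `3≤r` admitting a triple as the transversal.
  -- All coincidences except `w ≡ u` are excluded.
  meet-last : ∀ {a b c d u w} → Heavy H B₂ c d u → Heavy H B₂ a b w →
              All (a ≢_) (c ∷ d ∷ u ∷ []) → All (b ≢_) (c ∷ d ∷ u ∷ []) → w ≢ c → w ≢ d → w ≡ u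
  meet-last cdu abw a∉ b∉ w≢c w≢d with meets cdu (heavy-transversal abw) 3≤r
  ... | here a∈                                        = contradiction a∈ (All¬⇒¬Any a∉)
  ... | there (here b∈)                                = contradiction b∈ (All¬⇒¬Any b∉)
  ... | there (there (here (here w≡c)))                 = contradiction w≡c w≢c
  ... | there (there (here (there (here w≡d))))         = contradiction w≡d w≢d
  ... | there (there (here (there (there (here w≡u))))) = w≡u

  B₂≤B₁ : B₂ ≤ B₁
  B₂≤B₁ = m≤m+n (r * N) _

  B₁≤B₀ : B₁ ≤ B₀
  B₁≤B₀ = +-monoʳ-≤ (r * N) (*-monoʳ-≤ r B₂≤B₁)

  -- The vertex u that replaces b in bcd must be e whenever abe is heavy, because cdu meets abe.
  bridge : ∀ {a b c d} → Heavy H B₁ b c d → a ≢ c → a ≢ d →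
           ∃[ u ] Heavy H B₂ c d u × (∀ {e} → Heavy H B₁ a b e → e ≢ c → e ≢ d → e ≡ u)
  bridge {a} bcd@((b≢c , b≢d , _) , _) a≢c a≢d =
    let u , u≢a , u≢b , cdu = shift {B₂} (rotate bcd) a
    in u , cdu , λ abe → meet-last cdu (weaken B₂≤B₁ abe)
         (a≢c ∷ a≢d ∷ ≢-sym u≢a ∷ []) (b≢c ∷ b≢d ∷ ≢-sym u≢b ∷ [])

  -- The heavy triple `cdu` from `bridge` is `cde`, since `abe` forces `e ≡ u`.
  bridge-heavy : ∀ {a b c d e} → Heavy H B₁ b c d → Heavy H B₁ a b e →
                 a ≢ c → a ≢ d → e ≢ c → e ≢ d → Heavy H B₂ c d e
  bridge-heavy {c = c} {d} bcd abe a≢c a≢d e≢c e≢d =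
    let u , cdu , u-unique = bridge bcd a≢c a≢d
    in subst (Heavy H B₂ c d) (sym (u-unique abe e≢c e≢d)) cdu

  -- If neither of two vertices w₀ ≠ w₁ completing ab were d, both would equal the u of bridge.
  spread : ∀ {a b c d} → Heavy H B₀ a b c → Heavy H B₁ b c d → d ≢ a → Heavy H B₁ a b d
  spread {a} {b} {c} {d} abc@((_ , a≢c , _) , _) bcd d≢a =
    let w₀ , _ , w₀≢c , abw₀ = shift {B₁} abc c
        w₁ , w₁≢w₀ , w₁≢c , abw₁ = shift {B₁} abc w₀
    in choose abw₀ abw₁ w₀≢c w₁≢c w₁≢w₀
    where
    choose : ∀ {w₀ w₁} → Heavy H B₁ a b w₀ → Heavy H B₁ a b w₁ →
             w₀ ≢ c → w₁ ≢ c → w₁ ≢ w₀ → Heavy H B₁ a b d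
    choose {w₀} {w₁} abw₀ abw₁ w₀≢c w₁≢c w₁≢w₀ with w₀ ≟ᶠ d | w₁ ≟ᶠ d
    ... | yes refl | _        = abw₀
    ... | no _     | yes refl = abw₁
    ... | no w₀≢d  | no w₁≢d  =
      let u , _ , u-unique = bridge bcd a≢c (≢-sym d≢a)
      in contradiction (trans (u-unique abw₁ w₁≢c w₁≢d) (sym (u-unique abw₀ w₀≢c w₀≢d))) w₁≢w₀

  -- Containment of `H` in the 3-kernel system on `X`; equality is left to maximality.
  Core : Set
  Core = ∃[ X ] ∣ X ∣ ≡ 5 × (∀ {E} → E ∈ edges H → 3 ≤ ∣ E ∩ X ∣)

  -- `spread` and `bridge-heavy` turn the three given triples into all ten triples of the five
  -- vertices. As each of them is transversal, no edge misses three of the five vertices, so every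
  -- edge contains at least three.
  five-vertices : ∀ {a b c d e} → Heavy H B₀ a b c → Heavy H B₁ b c d → Heavy H B₁ b c e →
                  d ≢ a → e ≢ a → e ≢ d → Core
  five-vertices {a} {b} {c} {d} {e} abc@((a≢b , a≢c , b≢c) , _) bcd@((_ , b≢d , c≢d) , _)
    bce@((_ , b≢e , c≢e) , _) d≢a e≢a e≢d = fromList X , ∣fromList∣ unique , hits
    where
    X = a ∷ b ∷ c ∷ d ∷ e ∷ []
    acb = rotate (transpose abc)
    cbd = transpose bcd
    abd = spread abc bcd d≢a
    abe = spread abc bce e≢a
    acd = spread acb cbd d≢a
    ace = spread acb (transpose bce) e≢a
    -- The triples containing both `d` and `e`, other than `bce`, come out only `B₂`-heavy, which is
    -- enough for being transversal.
    cde = bridge-heavy bcd abe a≢c (≢-sym d≢a) (≢-sym c≢e) e≢d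
    ade = bridge-heavy (transpose acd) bce (≢-sym a≢b) b≢d e≢a e≢d
    bde = bridge-heavy cbd ace a≢b (≢-sym d≢a) (≢-sym b≢e) e≢d
    unique : Unique X
    unique = (a≢b ∷ a≢c ∷ ≢-sym d≢a ∷ ≢-sym e≢a ∷ []) ∷ (b≢c ∷ b≢d ∷ b≢e ∷ []) ∷
             (c≢d ∷ c≢e ∷ []) ∷ (≢-sym e≢d ∷ []) ∷ [] ∷ []
    hits : ∀ {E} → E ∈ edges H → 3 ≤ ∣ E ∩ fromList X ∣
    hits {E} E∈H = count (member (here refl)) (member (there (here refl)))
      (member (there (there (here refl)))) (member (there (there (there (here refl)))))
      (member (there (there (there (there (here refl))))))
      where
      S = E ∩ fromList X
      member : ∀ {x} → x ∈ X → x ∉ₛ E ⊎ x ∈ₛ S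
      member {x} x∈X with x ∈? E
      ... | yes x∈E = inj₂ (x∈p∩q⁺ (x∈E , ∈-fromList⁺ x∈X))
      ... | no x∉E  = inj₁ x∉E
      missed : ∀ {x y z} {G : Set} → Heavy H B₂ x y z → x ∉ₛ E → y ∉ₛ E → z ∉ₛ E → G
      missed xyz x∉ y∉ z∉ =
        contradiction (heavy-transversal xyz E∈H) (All¬⇒¬Any (x∉ ∷ y∉ ∷ z∉ ∷ []))
      hit : ∀ {x y z B} → Heavy H B x y z → x ∈ₛ S → y ∈ₛ S → z ∈ₛ S → 3 ≤ ∣ S ∣
      hit ((x≢y , x≢z , y≢z) , _) x∈ y∈ z∈ =
        length≤∣∣ S ((x≢y ∷ x≢z ∷ []) ∷ (y≢z ∷ []) ∷ [] ∷ []) (x∈ ∷ y∈ ∷ z∈ ∷ [])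
      low : ∀ {x y z} → Heavy H B₁ x y z → Heavy H B₂ x y z
      low = weaken B₂≤B₁
      -- Each case stops as soon as three vertices are known to be missed or three are known to be
      -- hit.
      count : a ∉ₛ E ⊎ a ∈ₛ S → b ∉ₛ E ⊎ b ∈ₛ S → c ∉ₛ E ⊎ c ∈ₛ S → d ∉ₛ E ⊎ d ∈ₛ S →
              e ∉ₛ E ⊎ e ∈ₛ S → 3 ≤ ∣ S ∣
      count (inj₁ a∉) (inj₁ b∉) (inj₁ c∉) _         _         = missed (low (weaken B₁≤B₀ abc)) a∉ b∉ c∉
      count (inj₁ a∉) (inj₁ b∉) (inj₂ _)  (inj₁ d∉) _         = missed (low abd) a∉ b∉ d∉
      count (inj₁ a∉) (inj₁ b∉) (inj₂ _)  (inj₂ _)  (inj₁ e∉) = missed (low abe) a∉ b∉ e∉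
      count (inj₁ _)  (inj₁ _)  (inj₂ c∈) (inj₂ d∈) (inj₂ e∈) = hit cde c∈ d∈ e∈
      count (inj₁ a∉) (inj₂ _)  (inj₁ c∉) (inj₁ d∉) _         = missed (low acd) a∉ c∉ d∉
      count (inj₁ a∉) (inj₂ _)  (inj₁ c∉) (inj₂ _)  (inj₁ e∉) = missed (low ace) a∉ c∉ e∉
      count (inj₁ _)  (inj₂ b∈) (inj₁ _)  (inj₂ d∈) (inj₂ e∈) = hit bde b∈ d∈ e∈
      count (inj₁ a∉) (inj₂ _)  (inj₂ _)  (inj₁ d∉) (inj₁ e∉) = missed ade a∉ d∉ e∉
      count (inj₁ _)  (inj₂ b∈) (inj₂ c∈) (inj₁ _)  (inj₂ e∈) = hit bce b∈ c∈ e∈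
      count (inj₁ _)  (inj₂ b∈) (inj₂ c∈) (inj₂ d∈) _         = hit bcd b∈ c∈ d∈
      count (inj₂ _)  (inj₁ b∉) (inj₁ c∉) (inj₁ d∉) _         = missed (low bcd) b∉ c∉ d∉
      count (inj₂ _)  (inj₁ b∉) (inj₁ c∉) (inj₂ _)  (inj₁ e∉) = missed (low bce) b∉ c∉ e∉
      count (inj₂ a∈) (inj₁ _)  (inj₁ _)  (inj₂ d∈) (inj₂ e∈) = hit ade a∈ d∈ e∈
      count (inj₂ _)  (inj₁ b∉) (inj₂ _)  (inj₁ d∉) (inj₁ e∉) = missed bde b∉ d∉ e∉
      count (inj₂ a∈) (inj₁ _)  (inj₂ c∈) (inj₁ _)  (inj₂ e∈) = hit ace a∈ c∈ e∈
      count (inj₂ a∈) (inj₁ _)  (inj₂ c∈) (inj₂ d∈) _         = hit acd a∈ c∈ d∈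
      count (inj₂ _)  (inj₂ _)  (inj₁ c∉) (inj₁ d∉) (inj₁ e∉) = missed cde c∉ d∉ e∉
      count (inj₂ a∈) (inj₂ b∈) (inj₁ _)  (inj₁ _)  (inj₂ e∈) = hit abe a∈ b∈ e∈
      count (inj₂ a∈) (inj₂ b∈) (inj₁ _)  (inj₂ d∈) _         = hit abd a∈ b∈ d∈
      count (inj₂ a∈) (inj₂ b∈) (inj₂ c∈) _         _         = hit abc a∈ b∈ c∈

  five-heavy : SomeHeavy B₀ → Core
  five-heavy (a , b , c , abc) =
    -- Both calls replace `a` in `bca`, so the new vertex differs from `a` anyway; the second call
    -- also has to avoid `d`.
    let d , _ , d≢a , bcd = shift {B₁} (rotate abc) a
        e , e≢d , e≢a , bce = shift {B₁} (rotate abc) d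
    in five-vertices abc bcd bce d≢a e≢a e≢d

  -- Since `r * B₁ ≤ B₀` and `r * B₂ ≤ B₁`, the edge count needed by `heaviest` also suffices for
  -- the two earlier searches.
  bound₁ : 3 * (r * (r * B₁)) ≤ 9 * (r * B₀)
  bound₁ = *-mono-≤ {3} {9} (m≤m+n 3 6) (*-monoʳ-≤ r (m≤n+m (r * B₁) (r * N)))
  bound₂ : r * (r * (r * B₂)) ≤ 9 * (r * B₀)
  bound₂ = ≤-trans (*-monoʳ-≤ r (*-monoʳ-≤ r (m≤n+m (r * B₂) (r * N))))
    (≤-trans (m≤n*m (r * (r * B₁)) 3) bound₁)

  -- A bootstrap: each triple found becomes a cheaper branching set for the next search. Reaching
  -- `B₀` thus costs `9 * r` instead of a cube of `r`, which the size of a kernel system can pay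
  -- for.
  core : 9 * (r * B₀) < ∣E H ∣ → Core
  core large =
    let _ , _ , _ , heavy₂ = some-heavy {B₂} (≤-<-trans bound₂ large)
        _ , _ , _ , heavy₁ = heavier {B₁} heavy₂ (≤-<-trans bound₁ large)
    in five-heavy (heaviest {B₀} heavy₁ (subst (_< ∣E H ∣) (*-assoc 3 3 (r * B₀)) large))

-- Further list counting.

unique-map : (f : A → B) {xs : List A} → (∀ {x y} → x ∈ xs → y ∈ xs → f x ≡ f y → x ≡ y) →
             Unique xs → Unique (map f xs)
unique-map f inj []       = []
unique-map f inj (x∉ ∷ u) =
  All.map⁺ (All.tabulate λ y∈ fx≡fy → All.lookup x∉ y∈ (inj (here refl) (there y∈) fx≡fy))
    ∷ unique-map f (λ x∈ y∈ → inj (there x∈) (there y∈)) u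

-- Turns maximality into equality of edge sets: a missing `y` consed onto `xs` would make a
-- duplicate-free list too long for `ys`.
⊆∧length≤⇒⊇ : DecidableEquality A → {xs ys : List A} → Unique xs → (∀ {x} → x ∈ xs → x ∈ ys) →
              length ys ≤ length xs → ∀ {y} → y ∈ ys → y ∈ xs
⊆∧length≤⇒⊇ _≟_ {xs} {ys} u xs⊆ys ys≤xs {y} y∈ys = decidable-stable (any? (y ≟_) xs) λ y∉xs →
  contradiction (length-mono-⊆ (All.¬Any⇒All¬ xs y∉xs ∷ u) λ { (here refl) → y∈ys ; (there p) → xs⊆ys p })
    (≤⇒≯ ys≤xs)

length-cartesianProductWith : {D : Set} (f : A → B → D) (xs : List A) (ys : List B) →
  length (cartesianProductWith f xs ys) ≡ length xs * length ys
length-cartesianProductWith f []       ys = refl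
length-cartesianProductWith f (x ∷ xs) ys = trans (length-++ (map (f x) ys))
  (cong₂ _+_ (length-map (f x) ys) (length-cartesianProductWith f xs ys))

-- Kernel systems of 5-sets: admissibility and size.

-- `supersets ⊥ r` enumerates all `r`-sets.
kernel : (r : ℕ) → Subset n → UniformHypergraph r n
kernel {n} r X = record
  { edges    = filter (λ E → 3 ≤? ∣ E ∩ X ∣) (supersets ⊥ r)
  ; distinct = Unique.filter⁺ (λ E → 3 ≤? ∣ E ∩ X ∣) (supersets-unique ⊥ r)
  ; uniform  = All.tabulate λ E∈ →
      trans (∈-supersets⁻ ⊥ r (proj₁ (∈-filter⁻ (λ E → 3 ≤? ∣ E ∩ X ∣) {xs = supersets ⊥ r} E∈)))
            (trans (cong (r +_) (∣⊥∣≡0 n)) (+-identityʳ r))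
  }

∈-kernel⁺ : {X E : Subset n} → ∣ E ∣ ≡ r → 3 ≤ ∣ E ∩ X ∣ → E ∈ edges (kernel r X)
∈-kernel⁺ {n = n} {r} {X} {E} ∣E∣ 3≤ = ∈-filter⁺ (λ E → 3 ≤? ∣ E ∩ X ∣)
  (∈-supersets⁺ ⊥ r (⊆-min E) (trans ∣E∣ (sym (trans (cong (r +_) (∣⊥∣≡0 n)) (+-identityʳ r))))) 3≤

∈-kernel⁻ : {X E : Subset n} → E ∈ edges (kernel r X) → 3 ≤ ∣ E ∩ X ∣
∈-kernel⁻ {r = r} {X} E∈ = proj₂ (∈-filter⁻ (λ E → 3 ≤? ∣ E ∩ X ∣) {xs = supersets ⊥ r} E∈)

-- Two disjoint edges would need 3 + 3 vertices of a 5-set.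
kernel-intersecting : {X : Subset n} → ∣ X ∣ ≡ 5 → Intersecting (kernel r X)
kernel-intersecting {X = X} ∣X∣ {E} {F} E∈ F∈ = decidable-stable (nonempty? (E ∩ F)) λ empty →
  contradiction (≤-trans (+-mono-≤ (∈-kernel⁻ E∈) (∈-kernel⁻ F∈))
    (∣∣-superadditive X (E ∩ X) (F ∩ X) (p∩q⊆q E X) (p∩q⊆q F X)
      λ x∈E x∈F → empty (_ , x∈p∩q⁺ (p∩q⊆p E X x∈E , p∩q⊆p F X x∈F))))
    (<⇒≱ (s≤s (≤-reflexive ∣X∣)))

degree-extensions : {X : Subset n} (S Y : Subset n) → suc ∣ S ∣ ≡ r →
  (∀ {y} → y ∈ₛ Y → y ∉ₛ S × 3 ≤ ∣ (S ∪ ⁅ y ⁆) ∩ X ∣) → ∣ Y ∣ ≤ degree (kernel r X) S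
degree-extensions {n = n} {r} {X} S Y ∣S∣ extends = begin
  ∣ Y ∣                            ≡⟨ length-elements Y ⟨
  length (elements Y)              ≡⟨ length-map extend (elements Y) ⟨
  length (map extend (elements Y)) ≤⟨ length-mono-⊆ (unique-map extend inj (elements-unique Y)) covered ⟩
  degree (kernel r X) S            ∎
  where
  open ≤-Reasoning
  extend : Fin n → Subset n
  extend y = S ∪ ⁅ y ⁆
  ∉S : ∀ {y} → y ∈ elements Y → y ∉ₛ S
  ∉S y∈ = proj₁ (extends (∈-elements⁻ Y y∈))
  inj : ∀ {y z} → y ∈ elements Y → z ∈ elements Y → extend y ≡ extend z → y ≡ z
  inj {y} {z} y∈ _ eq with x∈p∪q⁻ S ⁅ z ⁆ (subst (y ∈ₛ_) eq (x∈p∪q⁺ (inj₂ (x∈⁅x⁆ y))))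
  ... | inj₁ y∈S = contradiction y∈S (∉S y∈)
  ... | inj₂ y∈z = x∈⁅y⁆⇒x≡y z y∈z
  covered : ∀ {E} → E ∈ map extend (elements Y) → E ∈ filter (S ⊆?_) (edges (kernel r X))
  covered E∈ with ∈-map⁻ extend E∈
  ... | y , y∈ , refl = ∈-filter⁺ (S ⊆?_)
    (∈-kernel⁺ (trans (∣∪⁅⁆∣ S (∉S y∈)) ∣S∣) (proj₂ (extends (∈-elements⁻ Y y∈))))
    (p⊆p∪q ⁅ y ⁆)

-- If `S` has three vertices in `X`, each of the at least three vertices outside `S` extends it to
-- an edge. Otherwise an edge containing `S` adds one vertex only, so `S` has exactly two vertices
-- in `X`, and each of the at least three remaining vertices of `X` extends it.
kernel-codegrees : {X : Subset n} → ∣ X ∣ ≡ 5 → 3 ≤ r → r + 2 ≤ n → PositiveCodegrees≥ (kernel r X) 3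
kernel-codegrees {n = n} {r} {X} ∣X∣ 3≤r r+2≤n S ∣S∣ some
  with find some | 3 ≤? ∣ S ∩ X ∣ | trans (cong suc ∣S∣) (m+[n∸m]≡n {1} (≤-trans (s≤s z≤n) 3≤r))
... | _ | yes 3≤ | 1+∣S∣≡r = ≤-trans 3≤∁S (degree-extensions S (∁ S) 1+∣S∣≡r λ y∈ →
    x∈∁p⇒x∉p y∈ , ≤-trans 3≤ (p⊆q⇒∣p∣≤∣q∣ λ x∈ → let x∈S , x∈X = x∈p∩q⁻ S X x∈ in
      x∈p∩q⁺ (p⊆p∪q _ x∈S , x∈X)))
  where
  open ≤-Reasoning
  3≤∁S : 3 ≤ ∣ ∁ S ∣
  3≤∁S = begin
    3                  ≡⟨ m+n∸m≡n ∣ S ∣ 3 ⟨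
    ∣ S ∣ + 3 ∸ ∣ S ∣  ≡⟨ cong (_∸ ∣ S ∣) (trans (+-suc ∣ S ∣ 2) (cong (_+ 2) 1+∣S∣≡r)) ⟩
    r + 2 ∸ ∣ S ∣      ≤⟨ ∸-monoˡ-≤ ∣ S ∣ r+2≤n ⟩
    n ∸ ∣ S ∣          ≡⟨ ∣∁p∣≡n∸∣p∣ S ⟨
    ∣ ∁ S ∣            ∎
... | E , E∈ , S⊆E | no 3≰ | 1+∣S∣≡r = ≤-trans 3≤Y (degree-extensions S Y 1+∣S∣≡r extends)
  where
  Y = X ∩ ∁ S
  split : (T U : Subset n) → (∀ {x} → x ∈ₛ T → x ∈ₛ U) → ∀ {x} → x ∈ₛ T → x ∈ₛ S ∩ U ⊎ x ∈ₛ T ∩ ∁ S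
  split T U T⊆U {x} x∈T with x ∈? S
  ... | yes x∈S = inj₁ (x∈p∩q⁺ (x∈S , T⊆U x∈T))
  ... | no x∉S  = inj₂ (x∈p∩q⁺ (x∈T , x∉p⇒x∈∁p x∉S))
  3≤Y : 3 ≤ ∣ Y ∣
  3≤Y = +-cancelˡ-≤ 2 _ _ (≤-trans
    (subst (_≤ ∣ S ∩ X ∣ + ∣ Y ∣) ∣X∣ (∣∣-subadditive X (S ∩ X) Y (split X X id)))
    (+-monoˡ-≤ ∣ Y ∣ (s≤s⁻¹ (≰⇒> 3≰))))
  E∖S≤1 : ∣ E ∩ ∁ S ∣ ≤ 1
  E∖S≤1 = +-cancelʳ-≤ ∣ S ∣ _ _ (≤-trans
    (∣∣-superadditive E (E ∩ ∁ S) S (p∩q⊆p E (∁ S)) S⊆E (x∈∁p⇒x∉p ∘ p∩q⊆q E (∁ S)))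
    (≤-reflexive (trans (All.lookup (uniform (kernel r X)) E∈) (sym 1+∣S∣≡r))))
  2≤S∩X : 2 ≤ ∣ S ∩ X ∣
  2≤S∩X = +-cancelʳ-≤ 1 _ _ (≤-trans (∈-kernel⁻ E∈) (≤-trans
    (∣∣-subadditive (E ∩ X) (S ∩ X) (E ∩ ∁ S) λ x∈ →
      [ inj₁ , (λ p → inj₂ (x∈p∩q⁺ (p∩q⊆p E X x∈ , p∩q⊆q (E ∩ X) (∁ S) p))) ]′
        (split (E ∩ X) X (p∩q⊆q E X) x∈))
    (+-monoʳ-≤ ∣ S ∩ X ∣ E∖S≤1)))
  extends : ∀ {y} → y ∈ₛ Y → y ∉ₛ S × 3 ≤ ∣ (S ∪ ⁅ y ⁆) ∩ X ∣
  extends {y} y∈ = y∉S , ≤-trans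
    (+-mono-≤ 2≤S∩X (≤-reflexive (sym (∣⁅x⁆∣≡1 y))))
    (∣∣-superadditive ((S ∪ ⁅ y ⁆) ∩ X) (S ∩ X) ⁅ y ⁆
      (λ x∈ → x∈p∩q⁺ (p⊆p∪q _ (p∩q⊆p S X x∈) , p∩q⊆q S X x∈))
      (λ x∈ → x∈p∩q⁺ (q⊆p∪q S _ x∈ ,
        subst (_∈ₛ X) (sym (x∈⁅y⁆⇒x≡y y x∈)) (p∩q⊆p X (∁ S) y∈)))
      (λ x∈S x∈y → y∉S (subst (_∈ₛ S) (x∈⁅y⁆⇒x≡y y x∈y) (p∩q⊆p S X x∈S))))
    where
    y∉S : y ∉ₛ S
    y∉S = x∈∁p⇒x∉p (p∩q⊆q X (∁ S) y∈)

∣++∣ : ∀ {m} (p : Subset n) (s : Subset m) → ∣ p ++ᵥ s ∣ ≡ ∣ p ∣ + ∣ s ∣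
∣++∣ []            s = refl
∣++∣ (inside ∷ p)  s = cong suc (∣++∣ p s)
∣++∣ (outside ∷ p) s = ∣++∣ p s

∣p∣≤∣[p++s]∩[⊤++⊥]∣ : ∀ {m} (p : Subset n) (s : Subset m) → ∣ p ∣ ≤ ∣ (p ++ᵥ s) ∩ (⊤ {n} ++ᵥ ⊥ {m}) ∣
∣p∣≤∣[p++s]∩[⊤++⊥]∣ []            s = z≤n
∣p∣≤∣[p++s]∩[⊤++⊥]∣ (inside ∷ p)  s = s≤s (∣p∣≤∣[p++s]∩[⊤++⊥]∣ p s)
∣p∣≤∣[p++s]∩[⊤++⊥]∣ (outside ∷ p) s = ∣p∣≤∣[p++s]∩[⊤++⊥]∣ p s

-- Counts the edges with exactly three vertices among the first five: 10 choices of these three,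
-- times the `q`-sets of the other `m` vertices.
kernel-large : (m q : ℕ) → 10 * (m C q) ≤ ∣E kernel (3 + q) (⊤ {5} ++ᵥ ⊥ {m}) ∣
kernel-large m q = begin
  10 * (m C q)                                  ≡⟨ cong (λ k → 10 * (k C q)) ∣∁⊥∣ ⟨
  10 * (∣ ∁ (⊥ {m}) ∣ C q)                      ≡⟨ cong (10 *_) (length-supersets (⊥ {m}) q) ⟨
  -- `length heads` evaluates to 10.
  10 * length tails                             ≡⟨ length-cartesianProductWith _++ᵥ_ heads tails ⟨
  length (cartesianProductWith _++ᵥ_ heads tails) ≤⟨ length-mono-⊆
      (Unique.cartesianProductWith⁺ _++ᵥ_ (++-injective _ _)
        (supersets-unique (⊥ {5}) 3) (supersets-unique (⊥ {m}) q)) covered ⟩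
  _                                             ∎
  where
  open ≤-Reasoning
  ∣∁⊥∣ : ∣ ∁ (⊥ {m}) ∣ ≡ m
  ∣∁⊥∣ = trans (∣∁p∣≡n∸∣p∣ (⊥ {m})) (cong (m ∸_) (∣⊥∣≡0 m))
  heads = supersets (⊥ {5}) 3
  tails = supersets (⊥ {m}) q
  covered : ∀ {E} → E ∈ cartesianProductWith _++ᵥ_ heads tails →
            E ∈ edges (kernel (3 + q) (⊤ {5} ++ᵥ ⊥ {m}))
  covered E∈ with ∈-cartesianProductWith⁻ _++ᵥ_ heads tails E∈
  ... | p , s , p∈ , s∈ , refl = ∈-kernel⁺
    (trans (∣++∣ p s) (cong₂ _+_ ∣p∣
      (trans (∈-supersets⁻ ⊥ q s∈) (trans (cong (q +_) (∣⊥∣≡0 m)) (+-identityʳ q)))))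
    (≤-trans (≤-reflexive (sym ∣p∣)) (∣p∣≤∣[p++s]∩[⊤++⊥]∣ p s))
    where
    ∣p∣ : ∣ p ∣ ≡ 3
    ∣p∣ = ∈-supersets⁻ (⊥ {5}) 3 p∈

-- Binomial estimates.

nCk>0 : ∀ {n k} → k ≤ n → 0 < n C k
nCk>0 {n}     {zero}  _         = s≤s z≤n
nCk>0 {suc n} {suc k} (s≤s k≤n) = subst (0 <_) (nCk+nC[k+1]≡[n+1]C[k+1] n k)
  (<-≤-trans (nCk>0 k≤n) (m≤m+n (n C k) (n C suc k)))

nCk≤[n+1]Ck : ∀ n k → n C k ≤ suc n C k
nCk≤[n+1]Ck n zero    = ≤-refl
nCk≤[n+1]Ck n (suc k) = subst (n C suc k ≤_) (nCk+nC[k+1]≡[n+1]C[k+1] n k) (m≤n+m (n C suc k) (n C k))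

-- The rule `(k + 1) * C(n, k + 1) = (n - k) * C(n, k)` with the subtraction moved to the other
-- side, by induction through Pascal's rule.
k*nCk+[k+1]*nC[k+1]≡n*nCk : ∀ n k → k * (n C k) + suc k * (n C suc k) ≡ n * (n C k)
k*nCk+[k+1]*nC[k+1]≡n*nCk zero    zero    = refl
k*nCk+[k+1]*nC[k+1]≡n*nCk zero    (suc k) = cong₂ _+_
  (trans (cong (suc k *_) (k>n⇒nCk≡0 {0} {suc k} (s≤s z≤n))) (*-zeroʳ (suc k)))
  (trans (cong (suc (suc k) *_) (k>n⇒nCk≡0 {0} {suc (suc k)} (s≤s z≤n))) (*-zeroʳ (suc (suc k))))
k*nCk+[k+1]*nC[k+1]≡n*nCk (suc n) zero    =
  trans (*-identityˡ (suc n C 1)) (trans (nC1≡n (suc n)) (sym (*-identityʳ (suc n))))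
k*nCk+[k+1]*nC[k+1]≡n*nCk (suc n) (suc k) = begin
  suc k * (suc n C suc k) + suc (suc k) * (suc n C suc (suc k))
    ≡⟨ cong₂ (λ x y → suc k * x + suc (suc k) * y)
             (nCk+nC[k+1]≡[n+1]C[k+1] n k) (nCk+nC[k+1]≡[n+1]C[k+1] n (suc k)) ⟨
  suc k * (a + b) + suc (suc k) * (b + c)
    ≡⟨ solve 4 (λ k a b c → (con 1 :+ k) :* (a :+ b) :+ (con 2 :+ k) :* (b :+ c) :=
         (a :+ b) :+ ((k :* a :+ (con 1 :+ k) :* b) :+
                      ((con 1 :+ k) :* b :+ (con 2 :+ k) :* c))) refl k a b c ⟩
  (a + b) + ((k * a + suc k * b) + (suc k * b + suc (suc k) * c))
    ≡⟨ cong₂ (λ x y → (a + b) + (x + y))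
             (k*nCk+[k+1]*nC[k+1]≡n*nCk n k) (k*nCk+[k+1]*nC[k+1]≡n*nCk n (suc k)) ⟩
  (a + b) + (n * a + n * b)
    ≡⟨ solve 3 (λ n a b → (a :+ b) :+ (n :* a :+ n :* b) := (con 1 :+ n) :* (a :+ b)) refl n a b ⟩
  suc n * (a + b)
    ≡⟨ cong (suc n *_) (nCk+nC[k+1]≡[n+1]C[k+1] n k) ⟩
  suc n * (suc n C suc k) ∎
  where
  open ≡-Reasoning
  open +-*-Solver
  a = n C k
  b = n C suc k
  c = n C suc (suc k)

-- Consecutive binomial coefficients have ratio `(n - k) / (k + 1)`, which the hypothesis makes at
-- least `W`.
binomial-growth : ∀ W n k → suc k * W + k ≤ n → W * (n C k) ≤ n C suc k
binomial-growth W n k large = *-cancelˡ-≤ (suc k) (+-cancelˡ-≤ (k * N) _ _ (begin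
  k * N + suc k * (W * N)       ≡⟨ solve 3 (λ k W N →
    k :* N :+ (con 1 :+ k) :* (W :* N) := ((con 1 :+ k) :* W :+ k) :* N) refl k W N ⟩
  (suc k * W + k) * N           ≤⟨ *-monoˡ-≤ N large ⟩
  n * N                         ≡⟨ k*nCk+[k+1]*nC[k+1]≡n*nCk n k ⟨
  k * N + suc k * (n C suc k)   ∎))
  where
  open ≤-Reasoning
  open +-*-Solver
  N = n C k

-- The number of (3+q)-sets containing four given vertices out of 5 + m.
codegree₄ : ℕ → ℕ → ℕ
codegree₄ m zero    = 0
codegree₄ m (suc p) = suc m C p

-- With `s ≥ 4`, the left side plus `10 * N` is at most `16 * s ^ 4 * N`. The bound on `n` gives a
-- binomial ratio of at least `2 * s ^ 4`, hence `20 * s ^ 4 * N` on the right. The added `10 * N`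
-- pays for passing from `suc m` to `m` points by Pascal's rule.
threshold-small : ∀ m q → let s = 3 + q in 2 * s ^ 5 ≤ 5 + m →
                  9 * (s * threshold s (codegree₄ m q)) < 10 * (m C q)
-- An edge of size 3 contains no four vertices, so the left side is 0.
threshold-small m zero    _     = s≤s z≤n
threshold-small m (suc p) 2r⁵≤n = +-cancelʳ-< (10 * N) _ _ (begin-strict
  9 * (s * threshold s N) + 10 * N         ≡⟨ cong (λ x → 9 * x + 10 * N) expand ⟩
  9 * (x₂ + (x₃ + x₄)) + 10 * N            ≤⟨ +-mono-≤ (*-monoʳ-≤ 9 (+-monoˡ-≤ (x₃ + x₄) (grow x₂)))
                                                       (*-monoʳ-≤ 10 N≤x₃) ⟩
  9 * (x₃ + (x₃ + x₄)) + 10 * x₃           ≡⟨ solve 2 (λ x y →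
    con 9 :* (x :+ (x :+ y)) :+ con 10 :* x := con 7 :* (con 4 :* x) :+ con 9 :* y) refl x₃ x₄ ⟩
  7 * (4 * x₃) + 9 * x₄                    ≤⟨ +-monoˡ-≤ (9 * x₄) (*-monoʳ-≤ 7 (*-monoˡ-≤ x₃ 4≤s)) ⟩
  7 * x₄ + 9 * x₄                          ≡⟨ *-distribʳ-+ x₄ 7 9 ⟨
  16 * x₄                                  <⟨ *-monoˡ-< x₄ {{>-nonZero x₄>0}} (m≤m+n 17 3) ⟩
  20 * x₄                                  ≡⟨ solve 2 (λ s N →
    con 20 :* (s :* (s :* (s :* (s :* N)))) :=
    con 10 :* ((con 2 :* (s :* (s :* (s :* (s :* con 1))))) :* N)) refl s N ⟩
  10 * (W * N)                             ≤⟨ *-monoʳ-≤ 10 (binomial-growth W (suc m) p growth) ⟩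
  10 * (suc m C suc p)                     ≡⟨ cong (10 *_) (nCk+nC[k+1]≡[n+1]C[k+1] m p) ⟨
  10 * (m C p + m C suc p)                 ≤⟨ *-monoʳ-≤ 10 (+-monoˡ-≤ (m C suc p) (nCk≤[n+1]Ck m p)) ⟩
  10 * (N + m C suc p)                     ≡⟨ solve 2 (λ x y →
    con 10 :* (x :+ y) := con 10 :* y :+ con 10 :* x) refl N (m C suc p) ⟩
  10 * (m C suc p) + 10 * N                ∎)
  where
  open ≤-Reasoning
  open +-*-Solver
  s = 4 + p
  N = suc m C p
  W = 2 * s ^ 4
  x₁ = s * N
  x₂ = s * x₁
  x₃ = s * x₂
  x₄ = s * x₃
  expand : s * threshold s N ≡ x₂ + (x₃ + x₄)
  expand = solve 2 (λ s x →
    s :* (x :+ s :* (x :+ s :* x)) := s :* x :+ (s :* (s :* x) :+ s :* (s :* (s :* x)))) refl s x₁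
  4≤s : 4 ≤ s
  4≤s = m≤m+n 4 p
  grow : ∀ x → x ≤ s * x
  grow x = m≤n*m x s
  N≤x₃ : N ≤ x₃
  N≤x₃ = ≤-trans (grow N) (≤-trans (grow x₁) (grow x₂))
  growth : suc p * W + p ≤ suc m
  -- Adding 4 turns `p` into `s`, which is at most `3 * W`; together with `suc p` copies of `W` this
  -- makes `s * W`, that is `2 * s ^ 5`.
  growth = +-cancelʳ-≤ 4 _ _ (begin
    suc p * W + p + 4   ≡⟨ solve 2 (λ x p → x :+ p :+ con 4 := x :+ (con 4 :+ p)) refl (suc p * W) p ⟩
    suc p * W + s       ≤⟨ +-monoʳ-≤ (suc p * W) s≤3W ⟩
    suc p * W + 3 * W   ≡⟨ *-distribʳ-+ W (suc p) 3 ⟨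
    (suc p + 3) * W     ≡⟨ cong (_* W) (+-comm (suc p) 3) ⟩
    s * W               ≡⟨ solve 2 (λ s x → s :* (con 2 :* x) := con 2 :* (s :* x)) refl s (s ^ 4) ⟩
    2 * s ^ 5           ≤⟨ 2r⁵≤n ⟩
    5 + m               ≡⟨ +-comm 4 (suc m) ⟩
    suc m + 4           ∎)
    where
    s≤3W : s ≤ 3 * W
    s≤3W = ≤-trans (m≤m*n s (s ^ 3) {{m^n≢0 s 3}}) (≤-trans (m≤n*m (s ^ 4) 2) (m≤n*m W 3))
  p≤m : p ≤ suc m
  p≤m = ≤-trans (m≤n+m p (suc p * W)) growth
  x₄>0 : 0 < x₄
  x₄>0 = <-≤-trans (nCk>0 p≤m) (≤-trans N≤x₃ (grow x₃))

-- Degrees of four vertices, and comparison with the maximum.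

deg≤codegree₄ : ∀ {q m} → r ≡ 3 + q → n ≡ 5 + m → (H : UniformHypergraph r n) {T : List (Fin n)} →
                Unique T → length T ≡ 4 → deg H T ≤ codegree₄ m q
deg≤codegree₄ {q = zero} refl refl H {T} u ∣T∣ = length-mono-⊆ {ys = []} (star-unique H T) λ {E} E∈ →
  let E∈H , T⊆E = ∈-star⁻ H T E∈ in
  contradiction (≤-trans (≤-reflexive (sym ∣T∣)) (length≤∣∣ E u T⊆E))
    (<⇒≱ (s≤s (≤-reflexive (All.lookup (uniform H) E∈H))))
deg≤codegree₄ {q = suc p} {m} refl refl H {T} u ∣T∣ = begin
  deg H T                            ≤⟨ length-mono-⊆ (star-unique H T) covered ⟩
  length (supersets (fromList T) p)  ≡⟨ length-supersets (fromList T) p ⟩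
  ∣ ∁ (fromList T) ∣ C p             ≡⟨ cong (_C p) (trans (∣∁p∣≡n∸∣p∣ (fromList T))
                                                        (cong (5 + m ∸_) ∣T∣′)) ⟩
  suc m C p                          ∎
  where
  open ≤-Reasoning
  ∣T∣′ : ∣ fromList T ∣ ≡ 4
  ∣T∣′ = trans (∣fromList∣ u) ∣T∣
  covered : ∀ {E} → E ∈ star H T → E ∈ supersets (fromList T) p
  covered E∈ = let E∈H , T⊆E = ∈-star⁻ H T E∈ in
    ∈-supersets⁺ (fromList T) p (All.lookup T⊆E ∘ ∈-fromList⁻ T)
      (trans (All.lookup (uniform H) E∈H) (trans (+-comm 4 p) (cong (p +_) (sym ∣T∣′))))

length>0⇒∃∈ : {xs : List A} → 0 < length xs → ∃[ x ] x ∈ xs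
length>0⇒∃∈ {xs = x ∷ _} _ = x , here refl

δ⁺≥⇒PositiveCodegrees≥ : (H : UniformHypergraph r n) → ∀ {k} → δ⁺ H ≥ k → PositiveCodegrees≥ H k
δ⁺≥⇒PositiveCodegrees≥ H k≤δ S ∣S∣ some = ≤-trans k≤δ (δ⁺-valid H S ∣S∣ some)

-- An edge is supplied because `δ⁺` of an empty hypergraph is 0.
kernel-δ⁺ : {X : Subset n} → ∣ X ∣ ≡ 5 → 3 ≤ r → r + 2 ≤ n → ∀ {E} → E ∈ edges (kernel r X) →
            δ⁺ (kernel r X) ≥ 3
kernel-δ⁺ {r = r} {X} ∣X∣ 3≤r r+2≤n E∈ = δ⁺-largest (kernel r X) E∈ (kernel-codegrees ∣X∣ 3≤r r+2≤n)

-- The kernel system on `X` contains `H` and is itself a competitor, so it has no more edges than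
-- `H` and the two coincide.
contained-in-kernel : (H : UniformHypergraph r n) → 3 ≤ r → r + 2 ≤ n → ∀ {E₀} → E₀ ∈ edges H →
  (∀ (G : UniformHypergraph r n) → Intersecting G → δ⁺ G ≥ 3 → ∣E G ∣ ≤ ∣E H ∣) →
  (∃[ X ] ∣ X ∣ ≡ 5 × (∀ {E} → E ∈ edges H → 3 ≤ ∣ E ∩ X ∣)) → IsKernelSystem 3 H
contained-in-kernel {r} H 3≤r r+2≤n E₀∈H maximum (X , ∣X∣ , hits) = X , ∣X∣ , λ E → mk⇔
  (λ E∈H → All.lookup (uniform H) E∈H , hits E∈H)
  (λ (∣E∣ , 3≤E∩X) → ⊆∧length≤⇒⊇ (≡-dec _≟ᵇ_) (distinct H) H⊆kernel
    (maximum (kernel r X) (kernel-intersecting ∣X∣) (kernel-δ⁺ ∣X∣ 3≤r r+2≤n (H⊆kernel E₀∈H)))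
    (∈-kernel⁺ ∣E∣ 3≤E∩X))
  where
  H⊆kernel : ∀ {E} → E ∈ edges H → E ∈ edges (kernel r X)
  H⊆kernel E∈H = ∈-kernel⁺ (All.lookup (uniform H) E∈H) (hits E∈H)

large-kernel : ∀ {q m} → r ≡ 3 + q → n ≡ 5 + m → 2 * r ^ 5 ≤ n →
  ∃[ X ] ∣ X ∣ ≡ 5 × 9 * (r * threshold r (codegree₄ m q)) < ∣E_∣ {n = n} (kernel r X)
large-kernel {q = q} {m} refl refl 2r⁵≤n = ⊤ {5} ++ᵥ ⊥ {m} , cong (5 +_) (∣⊥∣≡0 m) ,
  <-≤-trans (threshold-small m q 2r⁵≤n) (kernel-large m q)

-- The kernel system competes with `H`; having more than `B` edges, it is non-empty, as `kernel-δ⁺`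
-- demands.
maximum-large : (H : UniformHypergraph r n) → 3 ≤ r → r + 2 ≤ n → ∀ {B} →
  (∀ (G : UniformHypergraph r n) → Intersecting G → δ⁺ G ≥ 3 → ∣E G ∣ ≤ ∣E H ∣) →
  ∃[ X ] ∣ X ∣ ≡ 5 × B < ∣E_∣ {n = n} (kernel r X) → B < ∣E H ∣
maximum-large {r} H 3≤r r+2≤n maximum (X , ∣X∣ , many) = <-≤-trans many
  (maximum (kernel r X) (kernel-intersecting ∣X∣)
    (kernel-δ⁺ ∣X∣ 3≤r r+2≤n (proj₂ (length>0⇒∃∈ (≤-<-trans z≤n many)))))

r+2≤2r⁵ : ∀ r → r ≥ 3 → r + 2 ≤ 2 * r ^ 5
r+2≤2r⁵ r@(suc _) 3≤r = begin
  r + 2          ≤⟨ +-mono-≤ r≤r⁵ (≤-trans (≤-trans (m≤m+n 2 1) 3≤r) r≤r⁵) ⟩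
  r ^ 5 + r ^ 5  ≡⟨ cong (r ^ 5 +_) (+-identityʳ (r ^ 5)) ⟨
  2 * r ^ 5      ∎
  where
  open ≤-Reasoning
  r≤r⁵ : r ≤ r ^ 5
  r≤r⁵ = m≤m*n r (r ^ 4) {{m^n≢0 r 4}}

theorem9 : ∀ (r n : ℕ) → r ≥ 3 → n ≥ 2 * r ^ 5 →
    (H : UniformHypergraph r n) → Intersecting H → δ⁺ H ≥ 3 →
    (∀ (G : UniformHypergraph r n) → Intersecting G → δ⁺ G ≥ 3 → ∣E G ∣ ≤ ∣E H ∣) →
    IsKernelSystem 3 H
theorem9 r n r≥3 n≥2r⁵ H inter δ≥3 maximum =
  let r+2≤n = ≤-trans (r+2≤2r⁵ r r≥3) n≥2r⁵
      -- `q` and `m` count the vertices of an edge beyond three and those of the ground set beyond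
      -- the five of `X`.
      q , 3+q≡r = m≤n⇒∃[o]m+o≡n r≥3
      m , 5+m≡n = m≤n⇒∃[o]m+o≡n (≤-trans (+-monoˡ-≤ 2 r≥3) r+2≤n)
      large = maximum-large H r≥3 r+2≤n maximum
                (large-kernel {q = q} {m} (sym 3+q≡r) (sym 5+m≡n) n≥2r⁵)
      E₀ , E₀∈H = length>0⇒∃∈ (≤-<-trans z≤n large)
  in contained-in-kernel H r≥3 r+2≤n E₀∈H maximum
       (Swapping.core H inter (δ⁺≥⇒PositiveCodegrees≥ H δ≥3) E₀∈H r≥3
         (deg≤codegree₄ {q = q} {m} (sym 3+q≡r) (sym 5+m≡n) H) large)
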